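{- (Few Rejections.) For the single-machine algorithm $\mathcal{A}$ described in the context, the total weight of the jobs in $J^{imm}$ (immediately rejected jobs) plus the total weight of the jobs that ever enter the set $L$ is at most $O(\epsilon)$ times the total weight of all released jobs.
   Context: Single machine; a finite set of jobs arrives online; job $j$ has integer release time $r_j$, integer processing time $p_j>0$ and weight $w_j>0$; its density is $\rho_j=w_j/p_j$. The parameter $\epsilon$ satisfies $\epsilon^2\le 1/2$ and $1/\epsilon\in\mathbb{Z}$. For $x>0$, $\lfloor x\rfloor_2$ denotes the largest integer $i$ with $2^i\le x$; $\lfloor\rho_j\rfloor_2$ is the density class of $j$. Algorithm $\mathcal{A}$ (which may reject and preempt) works in unit time slots. A job is active at time $t$ if it has been released by $t$, has not finished by $t$ and has not been rejected; $A(t)$ is the active set. $p_j(t)$ is the remaining processing time of $j$ at time $t$ and $w_j(t)=\rho_j p_j(t)$. A set $L$ of "preemptible" jobs is maintained; once a job enters $L$ it stays there until it finishes. At each integer time $t$: (1) each job arriving at $t$ (jobs arriving simultaneously are considered one at a time in a fixed arbitrary order, steps (1)-(2) being done for each) is either immediately rejected by the rule below or added to the active set; (2) if the job $j$ processed in slot $[t-1,t]$ is not in $L$, let $t'$ be the time $\mathcal{A}$ started processing $j$ (so $j$ was processed uninterruptedly during $[t',t]$); if the total weight of jobs arriving during $(t',t]$ exceeds $w_j/\epsilon$, then $j$ is added to $L$; (3) if the job processed in $[t-1,t]$ has not finished and is not in $L$, it is processed in $[t,t+1]$; otherwise $\mathcal{A}$ processes in $[t,t+1]$ an active job of highest density.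 Immediate rejection rule. For an arriving job $j$, $A(r_j)$ denotes the jobs active at time $r_j$, excluding $j$ and excluding jobs arriving at $r_j$ that are considered after $j$. Let $D_j^+=\{j'\in A(r_j):\lfloor\rho_{j'}\rfloor_2\ge\lfloor\rho_j\rfloor_2\}$, $D_j^-=A(r_j)\setminus D_j^+$, $\alpha_j^+=w_j\sum_{j'\in D_j^+,\rho_{j'}\ge\rho_j}p_{j'}(r_j)+p_j\sum_{j'\in D_j^+,\rho_{j'}<\rho_j}w_{j'}(r_j)$ and $\alpha_j^-=p_j\sum_{j'\in D_j^- }w_{j'}(r_j)$. Table $T^+$: if $\alpha_j^+\ge w_jp_j/\epsilon$, $j$ is assigned to the bucket $(\lfloor\alpha_j^+/w_j\rfloor_2,\lfloor w_j\rfloor_2)$ of $T^+$ (and put in the set $J^+$); in each bucket of $T^+$, the first job assigned to it is rejected, and then every $(1/\epsilon)$-th subsequent job assigned to it. Table $T^-$: if $\alpha_j^->w_jp_j/\epsilon$, $j$ is assigned to the bucket $(\lfloor\alpha_j^-\rfloor_2,\lfloor\rho_j\rfloor_2,\lfloor p_j\rfloor_2)$ of $T^-$ (and put in $J^-$); in each bucket of $T^-$, every $(1/\epsilon)$-th job assigned to it is rejected (the first rejected one being the $(1/\epsilon)$-th). A job may be assigned to both tables. $J^{imm}$ is the set of jobs rejected upon arrival by this rule. The constant in $O(\cdot)$ is absolute.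
   Formalization: The job weights w_j (and hence the densities) are taken to be positive rational numbers instead of positive real numbers. -}

module Defs where

open import Data.Bool using (Bool; true; false; if_then_else_; not; _∧_; _∨_)
open import Data.Nat as ℕ using (ℕ; zero; suc)
open import Data.Nat.DivMod using (_/_)
open import Data.Nat.Logarithm using (⌊log₂_⌋; ⌈log₂_⌉)
open import Data.Nat.Divisibility using (_∣?_)
open import Data.Integer as ℤ using (ℤ; +_; +[1+_]; -[1+_])
open import Data.Rational as ℚ using (ℚ; mkℚ; 0ℚ; _÷_)
open import Data.Fin as Fin using (Fin; toℕ)
open import Data.List using (List; []; _∷_; foldr; foldl; allFin)
open import Data.Maybe using (Maybe; just; nothing)
open import Data.Product using (_×_; _,_; Σ-syntax)
open import Relation.Nullary using (does; ¬_)
open import Relation.Binary.PropositionalEquality using (_≡_)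

-- ⌊ x ⌋₂ : the largest integer i with 2^i ≤ x, for a positive rational x.
-- For x = m/d (m,d ≥ 1):
--   * if d ≤ m :  i = ⌊log₂ ⌊m/d⌋⌋  (≥ 0), since for i ≥ 0, 2^i ≤ m/d ⇔ 2^i ≤ ⌊m/d⌋;
--   * if m < d :  i = - ⌈log₂ ⌈d/m⌉⌉ (< 0), since 2^(-k) ≤ m/d ⇔ ⌈d/m⌉ ≤ 2^k.
-- On non-positive rationals the value is junk (0); it is never used there.

⌊_⌋₂ : ℚ → ℤ
⌊ mkℚ +[1+ a ] b _ ⌋₂ =
  if suc b ℕ.≤ᵇ suc a
  then + ⌊log₂ (suc a / suc b) ⌋
  else ℤ.- (+ ⌈log₂ ((suc b ℕ.+ a) / suc a) ⌉)
⌊ _ ⌋₂ = + 0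

-- Total division on ℚ (x ⊘ 0 = 0; only ever used with a positive divisor).
_⊘_ : ℚ → ℚ → ℚ
x ⊘ q@(mkℚ (+ zero) _ _) = 0ℚ
x ⊘ q@(mkℚ +[1+ _ ] _ _) = x ÷ q
x ⊘ q@(mkℚ -[1+ _ ] _ _) = x ÷ q

_==ℤ_ : ℤ → ℤ → Bool
a ==ℤ b = does (a ℤ.≟ b)

Key⁺ : Set
Key⁺ = ℤ × ℤ

Key⁻ : Set
Key⁻ = ℤ × ℤ × ℤ

_==⁺_ : Key⁺ → Key⁺ → Bool
(a , b) ==⁺ (a' , b') = (a ==ℤ a') ∧ (b ==ℤ b')

_==⁻_ : Key⁻ → Key⁻ → Bool
(a , b , c) ==⁻ (a' , b' , c') = (a ==ℤ a') ∧ (b ==ℤ b') ∧ (c ==ℤ c')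

count : {A : Set} → (A → Bool) → List A → ℕ
count P [] = 0
count P (x ∷ xs) = if P x then suc (count P xs) else count P xs

-- The algorithm 𝒜.
-- k = 1/ε (a natural number); jobs are Fin n with release r, processing p,
-- weight w. Jobs arriving at the same time are considered in index order.

module Alg (k : ℕ) {n : ℕ} (r : Fin n → ℕ) (p : Fin n → ℕ) (w : Fin n → ℚ) where

  kℚ : ℚ
  kℚ = + k ℚ./ 1

  ℕtoℚ : ℕ → ℚ
  ℕtoℚ m = + m ℚ./ 1

  pℚ : Fin n → ℚ
  pℚ j = ℕtoℚ (p j)

  ρ : Fin n → ℚ
  ρ j = w j ⊘ pℚ j

  ∑ : (Fin n → ℚ) → ℚ
  ∑ f = foldr (λ j acc → f j ℚ.+ acc) 0ℚ (allFin n)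

  ∑If : (Fin n → Bool) → (Fin n → ℚ) → ℚ
  ∑If P f = ∑ (λ j → if P j then f j else 0ℚ)

  _<ᵇℚ_ : ℚ → ℚ → Bool
  x <ᵇℚ y = not (y ℚ.≤ᵇ x)

  upd : {A : Set} → (Fin n → A) → Fin n → A → Fin n → A
  upd f j v i = if does (i Fin.≟ j) then v else f i

  -- State of 𝒜 at an integer time t (before the events of time t).
  record State : Set where
    field
      rem   : Fin n → ℕ
      rej   : Fin n → Bool       -- j ∈ J^imm (rejected upon arrival)
      inL   : Fin n → Bool
      cur   : Maybe (Fin n)      -- job processed in slot [t-1,t] (if any)
      start : ℕ                  -- time t' at which 𝒜 started processing cur
      T⁺    : List Key⁺          -- multiset of buckets of jobs assigned to T⁺ so far
      T⁻    : List Key⁻          -- multiset of buckets of jobs assigned to T⁻ so far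
  open State public

  init : State
  init = record { rem = p ; rej = λ _ → false ; inL = λ _ → false
                ; cur = nothing ; start = 0 ; T⁺ = [] ; T⁻ = [] }

  wrem : State → Fin n → ℚ
  wrem s j = ρ j ℚ.* ℕtoℚ (rem s j)

  -- j' ∈ A(r_j) when job j (arriving at t) is considered
  inA : ℕ → Fin n → State → Fin n → Bool
  inA t j s j' =
    ((r j' ℕ.<ᵇ t) ∨ ((r j' ℕ.≡ᵇ t) ∧ (toℕ j' ℕ.<ᵇ toℕ j)))
    ∧ not (rej s j') ∧ (0 ℕ.<ᵇ rem s j')

  inD⁺ : Fin n → Fin n → Bool
  inD⁺ j j' = ⌊ ρ j ⌋₂ ℤ.≤ᵇ ⌊ ρ j' ⌋₂

  α⁺ : ℕ → Fin n → State → ℚ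
  α⁺ t j s =
      (w j ℚ.* ∑If (λ j' → inA t j s j' ∧ inD⁺ j j' ∧ (ρ j ℚ.≤ᵇ ρ j'))
                   (λ j' → ℕtoℚ (rem s j')))
    ℚ.+ (pℚ j ℚ.* ∑If (λ j' → inA t j s j' ∧ inD⁺ j j' ∧ (ρ j' <ᵇℚ ρ j)) (wrem s))

  α⁻ : ℕ → Fin n → State → ℚ
  α⁻ t j s = pℚ j ℚ.* ∑If (λ j' → inA t j s j' ∧ not (inD⁺ j j')) (wrem s)

  thr : Fin n → ℚ
  thr j = w j ℚ.* pℚ j ℚ.* kℚ

  key⁺ : ℕ → Fin n → State → Key⁺
  key⁺ t j s = (⌊ α⁺ t j s ⊘ w j ⌋₂ , ⌊ w j ⌋₂)

  key⁻ : ℕ → Fin n → State → Key⁻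
  key⁻ t j s = (⌊ α⁻ t j s ⌋₂ , ⌊ ρ j ⌋₂ , ⌊ pℚ j ⌋₂)

  toT⁺ : ℕ → Fin n → State → Bool
  toT⁺ t j s = thr j ℚ.≤ᵇ α⁺ t j s

  toT⁻ : ℕ → Fin n → State → Bool
  toT⁻ t j s = thr j <ᵇℚ α⁻ t j s

  c⁺ : ℕ → Fin n → State → ℕ
  c⁺ t j s = count (key⁺ t j s ==⁺_) (T⁺ s)

  c⁻ : ℕ → Fin n → State → ℕ
  c⁻ t j s = count (key⁻ t j s ==⁻_) (T⁻ s)

  -- T⁺: the 1st, (1+k)-th, (1+2k)-th, ... job of a bucket is rejected
  rej⁺ : ℕ → Fin n → State → Bool
  rej⁺ t j s = toT⁺ t j s ∧ does (k ∣? c⁺ t j s)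

  -- T⁻: the k-th, 2k-th, ... job of a bucket is rejected
  rej⁻ : ℕ → Fin n → State → Bool
  rej⁻ t j s = toT⁻ t j s ∧ does (k ∣? suc (c⁻ t j s))

  arrive : ℕ → Fin n → State → State
  arrive t j s = record s
    { rej = upd (rej s) j (rej⁺ t j s ∨ rej⁻ t j s)
    ; T⁺  = if toT⁺ t j s then key⁺ t j s ∷ T⁺ s else T⁺ s
    ; T⁻  = if toT⁻ t j s then key⁻ t j s ∷ T⁻ s else T⁻ s }

  arriveAll : ℕ → State → State
  arriveAll t s = foldl (λ s' j → if r j ℕ.≡ᵇ t then arrive t j s' else s') s (allFin n)

  arrivedW : ℕ → ℕ → ℚ
  arrivedW t' t = ∑If (λ i → (t' ℕ.<ᵇ r i) ∧ (r i ℕ.≤ᵇ t)) w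

  updLjob : ℕ → State → Fin n → State
  updLjob t s j =
    if inL s j then s
    else (if (w j ℚ.* kℚ) <ᵇℚ arrivedW (start s) t
          then record s { inL = upd (inL s) j true } else s)

  updL : ℕ → State → State
  updL t s with cur s
  ... | nothing = s
  ... | just j  = updLjob t s j

  mid : ℕ → State → State
  mid t s = updL t (arriveAll t s)

  continues : State → Bool
  continues s with cur s
  ... | nothing = false
  ... | just j  = (0 ℕ.<ᵇ rem s j) ∧ not (inL s j)

  Active : ℕ → State → Fin n → Set
  Active t s j = (r j ℕ.≤ t) × (rej s j ≡ false) × (0 ℕ.< rem s j)

  process : Fin n → State → State
  process j s = record s { rem = upd (rem s) j (rem s j ℕ.∸ 1) }

  -- step (3); the choice among active jobs of highest density is arbitrary
  data Step (t : ℕ) (s : State) : State → Set where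
    continue : ∀ j → cur (mid t s) ≡ just j → continues (mid t s) ≡ true →
               Step t s (process j (mid t s))
    pick     : ∀ j → continues (mid t s) ≡ false → Active t (mid t s) j →
               (∀ j' → Active t (mid t s) j' → ρ j' ℚ.≤ ρ j) →
               Step t s (record (process j (mid t s)) { cur = just j ; start = t })
    idle     : continues (mid t s) ≡ false → (∀ j → ¬ Active t (mid t s) j) →
               Step t s (record (mid t s) { cur = nothing })

  IsRun : (ℕ → State) → Set
  IsRun σ = (σ 0 ≡ init) × (∀ t → Step t (σ t) (σ (suc t)))

  totalW : ℚ
  totalW = ∑ w

  rejW : State → ℚ
  rejW s = ∑If (rej s) w

  LW : State → ℚ
  LW s = ∑If (inL s) w

{-# OPTIONS --safe #-}

-- Write k = 1/ε and W for the total weight. Each of the following weights is O(W/k).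
--
-- * Jobs in L: when j enters L, more than k w_j of weight has arrived since j was started, and these
--   time intervals are disjoint for different j.
-- * Jobs rejected by T⁻, and all but the first rejection in each bucket of T⁺: jobs of one bucket have
--   equal weight up to a factor 4, and each such rejection can be charged to k jobs of its bucket.
-- * First jobs of the buckets (i, m) of T⁺: put e = m − i. The jobs of density at least k 2^e / 4
--   include those that block such a job, so their volume V(e) is at least 2^i. For fixed e, summing
--   the geometric series over i gives Σ 2^m = 2^e Σ 2^i ≤ 2^(e+1) V(e). A job a counts towards V(e)
--   only if 2^e ≤ 4 ρ_a / k, so a second geometric sum bounds Σ 2^e V(e) by
--   Σ_a 8 p_a ρ_a / k = 8 W / k.
module Submission where

open import Defs
open import Data.Nat using (ℕ; _<_)
open import Data.Integer using (+_)
open import Data.Rational using (ℚ; _+_; _*_; _≤_; _/_; 1ℚ; ½; Positive)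
open import Data.Fin using (Fin)
open import Data.Product using (Σ)
open import Relation.Binary.PropositionalEquality using (_≡_)

open import Data.Bool using (Bool; true; false; if_then_else_; not; _∧_; _∨_)
open import Data.Bool.Properties using (T-≡; not-involutive)
open import Data.Fin as Fin using ()
open import Data.Integer as ℤ using (ℤ; +[1+_]; -[1+_])
import Data.Integer.Properties as ℤ
open import Data.List using (List; []; _∷_; _++_; foldr; foldl; map; allFin; cartesianProduct; downFrom; deduplicate)
open import Data.List.Membership.Propositional using (_∈_)
open import Data.List.Membership.Propositional.Properties
  using (∈-map⁺; ∈-downFrom⁺; ∈-cartesianProduct⁺; ∈-deduplicate⁺; ∈-allFin)
open import Data.List.Relation.Unary.All as All using (All; []; _∷_)
open import Data.List.Relation.Unary.AllPairs using ([]; _∷_)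
open import Data.List.Relation.Unary.Any using (here; there)
open import Data.List.Relation.Unary.Unique.DecPropositional.Properties using (deduplicate-!)
open import Data.List.Relation.Unary.Unique.Propositional using (Unique)
open import Data.List.Relation.Unary.Unique.Propositional.Properties
  using (map⁺; downFrom⁺; cartesianProduct⁺; allFin⁺)
open import Data.Maybe using (Maybe; just; nothing)
open import Data.Nat as ℕ using (zero; suc; z≤n; s≤s; _∸_; ⌊_/2⌋; ⌈_/2⌉)
open import Data.Nat.Coprimality using (1-coprimeTo) renaming (sym to coprime-sym)
open import Data.Nat.Divisibility using (_∣?_; divides)
open import Data.Nat.DivMod using (m/n*n≤m; m≡m%n+[m/n]*n; m%n<n; m≥n⇒m/n>0)
open import Data.Nat.Induction using (<-rec)
open import Data.Nat.Logarithm
import Data.Nat.Properties as ℕ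
open import Data.Product using (_×_; _,_; proj₁; proj₂; ∃)
open import Data.Rational as ℚ using (mkℚ; 0ℚ; *≤*)
import Data.Rational.Properties as ℚ
open import Data.Rational.Solver using (module +-*-Solver)
open import Data.Rational.Unnormalised using (mkℚᵘ; *≡*)
open import Function using (Equivalence)
open import Relation.Binary.Definitions using (DecidableEquality)
open import Relation.Binary.PropositionalEquality
  using (_≢_; refl; sym; trans; cong; cong₂; subst; subst₂; module ≡-Reasoning)
open import Relation.Nullary using (does; yes; no; contradiction; ofʸ; ofⁿ)
open import Relation.Nullary.Decidable using (dec-true; dec-false)
open import Algebra.Properties.AbelianGroup ℤ.+-0-abelianGroup using (∙-cancelˡ; ∙-cancelʳ; xyx⁻¹≈y)
open +-*-Solver using (solve; con; _:=_; _:+_; _:*_)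

private variable
  X Y : Set

-- Binary classes of rationals

ℕtoℚ : ℕ → ℚ
ℕtoℚ m = + m / 1

2ℚ : ℚ
2ℚ = + 2 / 1

-- The quotient `_/ 1` normalises through a gcd that is stuck on a variable. In constructor form,
-- sums and products of naturals compute.
ℕtoℚ-mkℚ : ∀ m → ℕtoℚ m ≡ mkℚ (+ m) 0 (coprime-sym (1-coprimeTo m))
ℕtoℚ-mkℚ m = ℚ.normalize-coprime (coprime-sym (1-coprimeTo m))

ℕtoℚ-+ : ∀ m n → ℕtoℚ (m ℕ.+ n) ≡ ℕtoℚ m + ℕtoℚ n
ℕtoℚ-+ m n = trans
  (cong (_/ 1) (sym (cong₂ ℤ._+_ (ℤ.*-identityʳ (+ m)) (ℤ.*-identityʳ (+ n)))))
  (sym (cong₂ _+_ (ℕtoℚ-mkℚ m) (ℕtoℚ-mkℚ n)))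

ℕtoℚ-* : ∀ m n → ℕtoℚ (m ℕ.* n) ≡ ℕtoℚ m * ℕtoℚ n
ℕtoℚ-* m n = trans (cong (_/ 1) (ℤ.pos-* m n)) (sym (cong₂ _*_ (ℕtoℚ-mkℚ m) (ℕtoℚ-mkℚ n)))

ℕtoℚ-mono-≤ : ∀ {m n} → m ℕ.≤ n → ℕtoℚ m ≤ ℕtoℚ n
ℕtoℚ-mono-≤ {m} {n} m≤n = subst₂ _≤_ (sym (ℕtoℚ-mkℚ m)) (sym (ℕtoℚ-mkℚ n))
  (*≤* (ℤ.*-monoʳ-≤-nonNeg (+ 1) (ℤ.+≤+ m≤n)))

ℕtoℚ-nonNeg : ∀ m → 0ℚ ≤ ℕtoℚ m
ℕtoℚ-nonNeg m = ℕtoℚ-mono-≤ {0} {m} z≤n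

ℕtoℚ-pos : ∀ m → .{{ℕ.NonZero m}} → Positive (ℕtoℚ m)
ℕtoℚ-pos m = ℚ.normalize-pos m 1

-- Clears the denominator, so that `fraction-≤` can compare rationals over ℕ.
*-↧ : ∀ x → x * ℕtoℚ (ℚ.↧ₙ x) ≡ ℚ.↥ x / 1
*-↧ x@(mkℚ n d _) = trans (cong (x *_) (ℕtoℚ-mkℚ (suc d)))
  (ℚ.fromℚᵘ-cong {mkℚᵘ (n ℤ.* + suc d) (d ℕ.* 1)} {mkℚᵘ n 0} (*≡* (ℤ.*-assoc n (+ suc d) (+ 1))))

*-monoˡ-≤ : ∀ {r p q} → 0ℚ ≤ r → p ≤ q → r * p ≤ r * q
*-monoˡ-≤ {r} 0≤r = ℚ.*-monoˡ-≤-nonNeg r {{ℚ.nonNegative 0≤r}}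

*-monoʳ-≤ : ∀ {r p q} → 0ℚ ≤ r → p ≤ q → p * r ≤ q * r
*-monoʳ-≤ {r} 0≤r = ℚ.*-monoʳ-≤-nonNeg r {{ℚ.nonNegative 0≤r}}

*-nonNeg : ∀ {p q} → 0ℚ ≤ p → 0ℚ ≤ q → 0ℚ ≤ p * q
*-nonNeg {p} {q} 0≤p 0≤q = subst (_≤ p * q) (ℚ.*-zeroʳ p) (*-monoˡ-≤ 0≤p 0≤q)

-- Negative exponents iterate `½`: no division arises, and the recursion follows the constructors of
-- ℤ.
pow2 : ℤ → ℚ
pow2 (+ zero)     = 1ℚ
pow2 (+ suc n)    = 2ℚ * pow2 (+ n)
pow2 -[1+ zero ]  = ½
pow2 -[1+ suc n ] = ½ * pow2 -[1+ n ]

pow2-suc : ∀ z → pow2 (ℤ.suc z) ≡ 2ℚ * pow2 z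
pow2-suc (+ n)        = refl
pow2-suc -[1+ zero ]  = refl
pow2-suc -[1+ suc n ] = trans (sym (ℚ.*-identityˡ _)) (ℚ.*-assoc 2ℚ ½ (pow2 -[1+ n ]))

pow2-pred : ∀ z → pow2 (ℤ.pred z) ≡ ½ * pow2 z
pow2-pred z = begin
  pow2 (ℤ.pred z)                ≡⟨ ℚ.*-identityˡ _ ⟨
  ½ * 2ℚ * pow2 (ℤ.pred z)       ≡⟨ ℚ.*-assoc ½ 2ℚ (pow2 (ℤ.pred z)) ⟩
  ½ * (2ℚ * pow2 (ℤ.pred z))     ≡⟨ cong (½ *_) (pow2-suc (ℤ.pred z)) ⟨
  ½ * pow2 (ℤ.suc (ℤ.pred z))    ≡⟨ cong (λ y → ½ * pow2 y) (ℤ.suc-pred z) ⟩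
  ½ * pow2 z ∎
  where open ≡-Reasoning

pow2-+ : ∀ y z → pow2 (y ℤ.+ z) ≡ pow2 y * pow2 z
pow2-+ (+ zero) z = trans (cong pow2 (ℤ.+-identityˡ z)) (sym (ℚ.*-identityˡ _))
pow2-+ (+ suc n) z = begin
  pow2 (+ suc n ℤ.+ z)           ≡⟨ cong pow2 (ℤ.+-assoc (+ 1) (+ n) z) ⟩
  pow2 (ℤ.suc (+ n ℤ.+ z))       ≡⟨ pow2-suc (+ n ℤ.+ z) ⟩
  2ℚ * pow2 (+ n ℤ.+ z)          ≡⟨ cong (2ℚ *_) (pow2-+ (+ n) z) ⟩
  2ℚ * (pow2 (+ n) * pow2 z)     ≡⟨ ℚ.*-assoc 2ℚ (pow2 (+ n)) (pow2 z) ⟨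
  2ℚ * pow2 (+ n) * pow2 z       ∎
  where open ≡-Reasoning
pow2-+ -[1+ zero ] z = pow2-pred z
pow2-+ -[1+ suc n ] z = begin
  pow2 (-[1+ suc n ] ℤ.+ z)          ≡⟨ cong pow2 (ℤ.+-assoc -[1+ 0 ] -[1+ n ] z) ⟩
  pow2 (ℤ.pred (-[1+ n ] ℤ.+ z))     ≡⟨ pow2-pred (-[1+ n ] ℤ.+ z) ⟩
  ½ * pow2 (-[1+ n ] ℤ.+ z)          ≡⟨ cong (½ *_) (pow2-+ -[1+ n ] z) ⟩
  ½ * (pow2 -[1+ n ] * pow2 z)       ≡⟨ ℚ.*-assoc ½ (pow2 -[1+ n ]) (pow2 z) ⟨
  ½ * pow2 -[1+ n ] * pow2 z         ∎
  where open ≡-Reasoning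

pow2-pos : ∀ z → Positive (pow2 z)
pow2-pos (+ zero)     = _
pow2-pos (+ suc n)    = ℚ.pos*pos⇒pos 2ℚ (pow2 (+ n)) {{pow2-pos (+ n)}}
pow2-pos -[1+ zero ]  = _
pow2-pos -[1+ suc n ] = ℚ.pos*pos⇒pos ½ (pow2 -[1+ n ]) {{pow2-pos -[1+ n ]}}

pow2-nonNeg : ∀ z → 0ℚ ≤ pow2 z
pow2-nonNeg z = ℚ.<⇒≤ (ℚ.positive⁻¹ (pow2 z) {{pow2-pos z}})

pow2-ℕ : ∀ n → pow2 (+ n) ≡ ℕtoℚ (2 ℕ.^ n)
pow2-ℕ zero    = refl
pow2-ℕ (suc n) = trans (cong (2ℚ *_) (pow2-ℕ n)) (sym (ℕtoℚ-* 2 (2 ℕ.^ n)))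

-- The quotient of the two powers has exponent `z - y ≥ 0`, so it is a natural power of two and at
-- least 1.
pow2-mono-≤ : ∀ {y z} → y ℤ.≤ z → pow2 y ≤ pow2 z
pow2-mono-≤ {y} {z} y≤z = begin
  pow2 y              ≡⟨ ℚ.*-identityʳ _ ⟨
  pow2 y * 1ℚ         ≤⟨ *-monoˡ-≤ (pow2-nonNeg y) (1≤pow2 (ℤ.i≤j⇒0≤j-i y≤z)) ⟩
  pow2 y * pow2 (z ℤ.- y)  ≡⟨ pow2-+ y (z ℤ.- y) ⟨
  pow2 (y ℤ.+ (z ℤ.- y))   ≡⟨ cong pow2 (trans (ℤ.+-comm y _) (trans (ℤ.+-assoc z (ℤ.- y) y) (trans (cong (λ x → z ℤ.+ x) (ℤ.+-inverseˡ y)) (ℤ.+-identityʳ z)))) ⟩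
  pow2 z              ∎
  where
  open ℚ.≤-Reasoning
  1≤pow2 : ∀ {x} → + 0 ℤ.≤ x → 1ℚ ≤ pow2 x
  1≤pow2 {+ n} _ = subst (1ℚ ≤_) (sym (pow2-ℕ n)) (ℕtoℚ-mono-≤ (ℕ.m^n>0 2 n))

-- Strong induction by halving: passing from n to ⌊n/2⌋ lowers the logarithm by one, and 2⌊n/2⌋ ≤ n.
2^⌊log₂⌋≤ : ∀ n → .{{ℕ.NonZero n}} → 2 ℕ.^ ⌊log₂ n ⌋ ℕ.≤ n
2^⌊log₂⌋≤ = <-rec _ go
  where
  open ℕ.≤-Reasoning
  go : ∀ n → (∀ {m} → m ℕ.< n → .{{ℕ.NonZero m}} → 2 ℕ.^ ⌊log₂ m ⌋ ℕ.≤ m) →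
       .{{ℕ.NonZero n}} → 2 ℕ.^ ⌊log₂ n ⌋ ℕ.≤ n
  go (suc zero)      _  = ℕ.≤-refl
  go n@(suc (suc l)) ih = begin
    2 ℕ.^ ⌊log₂ n ⌋                     ≡⟨ cong (2 ℕ.^_) (ℕ.m∸n+n≡m 1≤log) ⟨
    2 ℕ.^ (⌊log₂ n ⌋ ℕ.∸ 1 ℕ.+ 1)       ≡⟨ cong (2 ℕ.^_) (ℕ.+-comm (⌊log₂ n ⌋ ℕ.∸ 1) 1) ⟩
    2 ℕ.* 2 ℕ.^ (⌊log₂ n ⌋ ℕ.∸ 1)       ≡⟨ cong (λ x → 2 ℕ.* 2 ℕ.^ x) (⌊log₂⌊n/2⌋⌋≡⌊log₂n⌋∸1 n) ⟨
    2 ℕ.* 2 ℕ.^ ⌊log₂ ⌊ n /2⌋ ⌋         ≤⟨ ℕ.*-monoʳ-≤ 2 (ih (ℕ.⌊n/2⌋<n (suc l))) ⟩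
    2 ℕ.* ⌊ n /2⌋                       ≡⟨ cong (λ x → ⌊ n /2⌋ ℕ.+ x) (ℕ.+-identityʳ _) ⟩
    ⌊ n /2⌋ ℕ.+ ⌊ n /2⌋                 ≤⟨ ℕ.+-monoʳ-≤ ⌊ n /2⌋ (ℕ.⌊n/2⌋≤⌈n/2⌉ n) ⟩
    ⌊ n /2⌋ ℕ.+ ⌈ n /2⌉                 ≡⟨ ℕ.⌊n/2⌋+⌈n/2⌉≡n n ⟩
    n                                   ∎
    where
    -- Guards against the truncation of `∸`; it holds because n ≥ 2.
    1≤log : 1 ℕ.≤ ⌊log₂ n ⌋
    1≤log = ⌊log₂⌋-mono-≤ {2} {n} (s≤s (s≤s z≤n))

-- Otherwise monotonicity of the logarithm on 2^(l+1) ≤ n, with l = ⌊log₂ n⌋, would give l + 1 ≤ l.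
<2^suc⌊log₂⌋ : ∀ n → n ℕ.< 2 ℕ.^ suc ⌊log₂ n ⌋
<2^suc⌊log₂⌋ n = ℕ.≰⇒> λ le →
  ℕ.1+n≰n (subst (ℕ._≤ ⌊log₂ n ⌋) (⌊log₂[2^n]⌋≡n (suc ⌊log₂ n ⌋)) (⌊log₂⌋-mono-≤ le))

-- Halving again, now rounded up, since n ≤ 2⌈n/2⌉.
≤2^⌈log₂⌉ : ∀ n → n ℕ.≤ 2 ℕ.^ ⌈log₂ n ⌉
≤2^⌈log₂⌉ = <-rec _ go
  where
  open ℕ.≤-Reasoning
  go : ∀ n → (∀ {m} → m ℕ.< n → m ℕ.≤ 2 ℕ.^ ⌈log₂ m ⌉) → n ℕ.≤ 2 ℕ.^ ⌈log₂ n ⌉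
  go zero            _  = z≤n
  go (suc zero)      _  = ℕ.≤-refl
  go n@(suc (suc l)) ih = begin
    n                                   ≡⟨ ℕ.⌊n/2⌋+⌈n/2⌉≡n n ⟨
    ⌊ n /2⌋ ℕ.+ ⌈ n /2⌉                 ≤⟨ ℕ.+-monoˡ-≤ ⌈ n /2⌉ (ℕ.⌊n/2⌋≤⌈n/2⌉ n) ⟩
    ⌈ n /2⌉ ℕ.+ ⌈ n /2⌉                 ≡⟨ cong (λ x → ⌈ n /2⌉ ℕ.+ x) (ℕ.+-identityʳ _) ⟨
    2 ℕ.* ⌈ n /2⌉                       ≤⟨ ℕ.*-monoʳ-≤ 2 (ih (ℕ.⌈n/2⌉<n l)) ⟩
    2 ℕ.* 2 ℕ.^ ⌈log₂ ⌈ n /2⌉ ⌉         ≡⟨ cong (λ x → 2 ℕ.* 2 ℕ.^ x) (⌈log₂⌈n/2⌉⌉≡⌈log₂n⌉∸1 n) ⟩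
    2 ℕ.* 2 ℕ.^ (⌈log₂ n ⌉ ℕ.∸ 1)       ≡⟨ cong (2 ℕ.^_) (ℕ.+-comm (⌈log₂ n ⌉ ℕ.∸ 1) 1) ⟨
    2 ℕ.^ (⌈log₂ n ⌉ ℕ.∸ 1 ℕ.+ 1)       ≡⟨ cong (2 ℕ.^_) (ℕ.m∸n+n≡m 1≤log) ⟩
    2 ℕ.^ ⌈log₂ n ⌉                     ∎
    where
    1≤log : 1 ℕ.≤ ⌈log₂ n ⌉
    1≤log = ⌈log₂⌉-mono-≤ {2} {n} (s≤s (s≤s z≤n))

<⌈log₂⌉⇒2^< : ∀ n c → c ℕ.< ⌈log₂ n ⌉ → 2 ℕ.^ c ℕ.< n
<⌈log₂⌉⇒2^< n c c< = ℕ.≰⇒> λ le →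
  ℕ.<⇒≱ c< (subst (⌈log₂ n ⌉ ℕ.≤_) (⌈log₂2^n⌉≡n c) (⌈log₂⌉-mono-≤ le))

pow2-neg : ∀ n → pow2 (ℤ.- (+ n)) * ℕtoℚ (2 ℕ.^ n) ≡ 1ℚ
pow2-neg n = begin
  pow2 (ℤ.- (+ n)) * ℕtoℚ (2 ℕ.^ n)  ≡⟨ cong (pow2 (ℤ.- (+ n)) *_) (pow2-ℕ n) ⟨
  pow2 (ℤ.- (+ n)) * pow2 (+ n)      ≡⟨ pow2-+ (ℤ.- (+ n)) (+ n) ⟨
  pow2 (ℤ.- (+ n) ℤ.+ + n)           ≡⟨ cong pow2 (ℤ.+-inverseˡ (+ n)) ⟩
  1ℚ                                 ∎
  where open ≡-Reasoning

-- Cross-multiplication for x = m/d and y = v/u; it moves the estimates of `⌊⌋₂-bounds` into ℕ.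
fraction-≤ : ∀ x y m d v u .{{_ : ℕ.NonZero d}} .{{_ : ℕ.NonZero u}} →
             x * ℕtoℚ d ≡ ℕtoℚ m → y * ℕtoℚ u ≡ ℕtoℚ v →
             m ℕ.* u ℕ.≤ v ℕ.* d → x ≤ y
fraction-≤ x y m d v u xd≡m yu≡v mu≤vd = ℚ.*-cancelʳ-≤-pos (ℕtoℚ d * ℕtoℚ u) {{pos}} (begin
  x * (ℕtoℚ d * ℕtoℚ u)    ≡⟨ ℚ.*-assoc x (ℕtoℚ d) (ℕtoℚ u) ⟨
  x * ℕtoℚ d * ℕtoℚ u      ≡⟨ cong (_* ℕtoℚ u) xd≡m ⟩
  ℕtoℚ m * ℕtoℚ u          ≡⟨ ℕtoℚ-* m u ⟨
  ℕtoℚ (m ℕ.* u)           ≤⟨ ℕtoℚ-mono-≤ mu≤vd ⟩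
  ℕtoℚ (v ℕ.* d)           ≡⟨ ℕtoℚ-* v d ⟩
  ℕtoℚ v * ℕtoℚ d          ≡⟨ cong (_* ℕtoℚ d) yu≡v ⟨
  y * ℕtoℚ u * ℕtoℚ d      ≡⟨ solve 3 (λ a b c → a :* b :* c := a :* (c :* b)) refl y (ℕtoℚ u) (ℕtoℚ d) ⟩
  y * (ℕtoℚ d * ℕtoℚ u)    ∎)
  where
  open ℚ.≤-Reasoning
  pos : Positive (ℕtoℚ d * ℕtoℚ u)
  pos = ℚ.pos*pos⇒pos (ℕtoℚ d) {{ℕtoℚ-pos d}} (ℕtoℚ u) {{ℕtoℚ-pos u}}

-- The cases are those of the definition. For x ≥ 1 the remainder lost in ⌊m/d⌋ = q is absorbed by q
-- < 2^(l+1); for x < 1 the reciprocal is rounded up instead.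
⌊⌋₂-bounds : ∀ x → Positive x → pow2 ⌊ x ⌋₂ ≤ x × x ≤ 2ℚ * pow2 ⌊ x ⌋₂
⌊⌋₂-bounds x@(mkℚ +[1+ a ] b _) _
  with suc b ℕ.≤ᵇ suc a | ℕ.≤ᵇ-reflects-≤ (suc b) (suc a)
... | true | ofʸ d≤m =
    fraction-≤ (pow2 (+ l)) x (2 ℕ.^ l) 1 m d (trans (ℚ.*-identityʳ (pow2 (+ l))) (pow2-ℕ l)) (*-↧ x) lower
  , fraction-≤ x (pow2 (+ suc l)) m d (2 ℕ.^ suc l) 1 (*-↧ x) (trans (ℚ.*-identityʳ (pow2 (+ suc l))) (pow2-ℕ (suc l))) upper
  where
  open ℕ.≤-Reasoning
  m = suc a
  d = suc b
  q = m ℕ./ d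
  l = ⌊log₂ q ⌋
  lower : 2 ℕ.^ l ℕ.* d ℕ.≤ m ℕ.* 1
  lower = begin
    2 ℕ.^ l ℕ.* d  ≤⟨ ℕ.*-monoˡ-≤ d (2^⌊log₂⌋≤ q {{ℕ.>-nonZero (m≥n⇒m/n>0 d≤m)}}) ⟩
    q ℕ.* d        ≤⟨ m/n*n≤m m d ⟩
    m              ≡⟨ ℕ.*-identityʳ m ⟨
    m ℕ.* 1        ∎
  upper : m ℕ.* 1 ℕ.≤ 2 ℕ.^ suc l ℕ.* d
  upper = begin
    m ℕ.* 1                 ≡⟨ ℕ.*-identityʳ m ⟩
    m                       ≡⟨ m≡m%n+[m/n]*n m d ⟩
    m ℕ.% d ℕ.+ q ℕ.* d     ≤⟨ ℕ.+-monoˡ-≤ (q ℕ.* d) (ℕ.<⇒≤ (m%n<n m d)) ⟩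
    suc q ℕ.* d             ≤⟨ ℕ.*-monoˡ-≤ d (<2^suc⌊log₂⌋ q) ⟩
    2 ℕ.^ suc l ℕ.* d       ∎
... | false | ofⁿ d≰m =
    fraction-≤ y x 1 (2 ℕ.^ l) m d {{ℕ.m^n≢0 2 l}} (pow2-neg l) (*-↧ x) lower
  , fraction-≤ x (2ℚ * y) m d 2 (2 ℕ.^ l) {{_}} {{ℕ.m^n≢0 2 l}} (*-↧ x)
      (trans (ℚ.*-assoc 2ℚ y (ℕtoℚ (2 ℕ.^ l))) (cong (2ℚ *_) (pow2-neg l))) upper
  where
  open ℕ.≤-Reasoning
  m = suc a
  d = suc b
  -- As a = m - 1, this floor division is the ceiling of d/m.
  q = (d ℕ.+ a) ℕ./ m
  l = ⌈log₂ q ⌉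
  y = pow2 (ℤ.- (+ l))
  d≤qm : d ℕ.≤ q ℕ.* m
  d≤qm = ℕ.+-cancelˡ-≤ a d (q ℕ.* m) (begin
    a ℕ.+ d                          ≡⟨ ℕ.+-comm a d ⟩
    d ℕ.+ a                          ≡⟨ m≡m%n+[m/n]*n (d ℕ.+ a) m ⟩
    (d ℕ.+ a) ℕ.% m ℕ.+ q ℕ.* m      ≤⟨ ℕ.+-monoˡ-≤ (q ℕ.* m) (ℕ.s≤s⁻¹ (m%n<n (d ℕ.+ a) m)) ⟩
    a ℕ.+ q ℕ.* m                    ∎)
  lower : 1 ℕ.* d ℕ.≤ m ℕ.* 2 ℕ.^ l
  lower = begin
    1 ℕ.* d          ≡⟨ ℕ.*-identityˡ d ⟩
    d                ≤⟨ d≤qm ⟩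
    q ℕ.* m          ≤⟨ ℕ.*-monoˡ-≤ m (≤2^⌈log₂⌉ q) ⟩
    2 ℕ.^ l ℕ.* m    ≡⟨ ℕ.*-comm (2 ℕ.^ l) m ⟩
    m ℕ.* 2 ℕ.^ l    ∎
  -- Makes l positive, so that c is a true predecessor of l.
  1<q : 1 ℕ.< q
  1<q = ℕ.*-cancelʳ-< m 1 q (begin-strict
    1 ℕ.* m   ≡⟨ ℕ.*-identityˡ m ⟩
    m         <⟨ ℕ.≰⇒> d≰m ⟩
    d         ≤⟨ d≤qm ⟩
    q ℕ.* m   ∎)
  c = l ℕ.∸ 1
  suc-c≡l : suc c ≡ l
  suc-c≡l = ℕ.m+[n∸m]≡n (⌈log₂⌉-mono-≤ {2} {q} 1<q)
  upper : m ℕ.* 2 ℕ.^ l ℕ.≤ 2 ℕ.* d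
  upper = begin
    m ℕ.* 2 ℕ.^ l             ≡⟨ cong (λ e → m ℕ.* 2 ℕ.^ e) suc-c≡l ⟨
    m ℕ.* (2 ℕ.* 2 ℕ.^ c)     ≡⟨ ℕ.*-comm m (2 ℕ.* 2 ℕ.^ c) ⟩
    2 ℕ.* 2 ℕ.^ c ℕ.* m       ≡⟨ ℕ.*-assoc 2 (2 ℕ.^ c) m ⟩
    -- From c < ⌈log₂ q⌉ follows 2^c + 1 ≤ q; the spare multiple of m absorbs the `a` added for
    -- rounding up.
    2 ℕ.* (2 ℕ.^ c ℕ.* m)     ≤⟨ ℕ.*-monoʳ-≤ 2 (ℕ.+-cancelʳ-≤ a (2 ℕ.^ c ℕ.* m) d (begin
      2 ℕ.^ c ℕ.* m ℕ.+ a       ≤⟨ ℕ.+-monoʳ-≤ (2 ℕ.^ c ℕ.* m) (ℕ.n≤1+n a) ⟩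
      2 ℕ.^ c ℕ.* m ℕ.+ m       ≡⟨ ℕ.+-comm (2 ℕ.^ c ℕ.* m) m ⟩
      suc (2 ℕ.^ c) ℕ.* m       ≤⟨ ℕ.*-monoˡ-≤ m (<⌈log₂⌉⇒2^< q c (ℕ.≤-reflexive suc-c≡l)) ⟩
      q ℕ.* m                   ≤⟨ m/n*n≤m (d ℕ.+ a) m ⟩
      d ℕ.+ a                   ∎)) ⟩
    2 ℕ.* d                   ∎

-- Finite sums and ranks

sumOver : (X → ℚ) → List X → ℚ
sumOver f = foldr (λ x acc → f x + acc) 0ℚ

sumOver-mono : ∀ (f g : X → ℚ) xs → (∀ x → f x ≤ g x) → sumOver f xs ≤ sumOver g xs
sumOver-mono f g []       f≤g = ℚ.≤-refl
sumOver-mono f g (x ∷ xs) f≤g = ℚ.+-mono-≤ (f≤g x) (sumOver-mono f g xs f≤g)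

sumOver-cong : ∀ (f g : X → ℚ) xs → (∀ x → f x ≡ g x) → sumOver f xs ≡ sumOver g xs
sumOver-cong f g []       f≡g = refl
sumOver-cong f g (x ∷ xs) f≡g = cong₂ _+_ (f≡g x) (sumOver-cong f g xs f≡g)

sumOver-0 : ∀ (xs : List X) → sumOver (λ _ → 0ℚ) xs ≡ 0ℚ
sumOver-0 []       = refl
sumOver-0 (x ∷ xs) = trans (ℚ.+-identityˡ (sumOver (λ _ → 0ℚ) xs)) (sumOver-0 xs)

0≤if : ∀ b {v} → 0ℚ ≤ v → 0ℚ ≤ (if b then v else 0ℚ)
0≤if true  0≤v = 0≤v
0≤if false _   = ℚ.≤-refl

if-≤ : ∀ b {v} → 0ℚ ≤ v → (if b then v else 0ℚ) ≤ v
if-≤ true  _   = ℚ.≤-refl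
if-≤ false 0≤v = 0≤v

sumOver-nonNeg : ∀ (f : X → ℚ) xs → (∀ x → 0ℚ ≤ f x) → 0ℚ ≤ sumOver f xs
sumOver-nonNeg f xs 0≤f = ℚ.≤-trans (ℚ.≤-reflexive (sym (sumOver-0 xs))) (sumOver-mono (λ _ → 0ℚ) f xs 0≤f)

sumOver-+ : ∀ (f g : X → ℚ) xs → sumOver (λ x → f x + g x) xs ≡ sumOver f xs + sumOver g xs
sumOver-+ f g []       = refl
sumOver-+ f g (x ∷ xs) = trans (cong (λ y → f x + g x + y) (sumOver-+ f g xs))
  (solve 4 (λ a b c d → a :+ b :+ (c :+ d) := a :+ c :+ (b :+ d)) refl
    (f x) (g x) (sumOver f xs) (sumOver g xs))

sumOver-* : ∀ c (f : X → ℚ) xs → sumOver (λ x → c * f x) xs ≡ c * sumOver f xs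
sumOver-* c f []       = sym (ℚ.*-zeroʳ c)
sumOver-* c f (x ∷ xs) = trans (cong (λ y → c * f x + y) (sumOver-* c f xs))
  (sym (ℚ.*-distribˡ-+ c (f x) (sumOver f xs)))

sumOver-++ : ∀ (f : X → ℚ) xs ys → sumOver f (xs ++ ys) ≡ sumOver f xs + sumOver f ys
sumOver-++ f []       ys = sym (ℚ.+-identityˡ (sumOver f ys))
sumOver-++ f (x ∷ xs) ys = trans (cong (λ y → f x + y) (sumOver-++ f xs ys))
  (sym (ℚ.+-assoc (f x) (sumOver f xs) (sumOver f ys)))

sumOver-map : ∀ (f : Y → ℚ) (g : X → Y) xs → sumOver f (map g xs) ≡ sumOver (λ x → f (g x)) xs
sumOver-map f g []       = refl
sumOver-map f g (x ∷ xs) = cong (λ y → f (g x) + y) (sumOver-map f g xs)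

sumOver-× : ∀ (f : X × Y → ℚ) xs ys →
  sumOver f (cartesianProduct xs ys) ≡ sumOver (λ x → sumOver (λ y → f (x , y)) ys) xs
sumOver-× f []       ys = refl
sumOver-× f (x ∷ xs) ys = trans (sumOver-++ f (map (x ,_) ys) (cartesianProduct xs ys))
  (cong₂ _+_ (sumOver-map f (x ,_) ys) (sumOver-× f xs ys))

sumOver-swap : ∀ (f : X → Y → ℚ) xs ys →
  sumOver (λ x → sumOver (f x) ys) xs ≡ sumOver (λ y → sumOver (λ x → f x y) xs) ys
sumOver-swap f []       ys = sym (sumOver-0 ys)
sumOver-swap f (x ∷ xs) ys = trans (cong (λ y → sumOver (f x) ys + y) (sumOver-swap f xs ys))
  (sym (sumOver-+ (f x) (λ y → sumOver (λ x → f x y) xs) ys))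

-- The order is decreasing, so the first exponent that a geometric sum meets is its largest.
integersFrom : ℕ → ℕ → List ℤ
integersFrom lo len = map (λ a → + a ℤ.- + lo) (downFrom len)

sumOver-pow2 : ∀ lo len → sumOver pow2 (integersFrom lo len) ≤ pow2 (+ len ℤ.- + lo)
sumOver-pow2 lo zero      = pow2-nonNeg (+ 0 ℤ.- + lo)
sumOver-pow2 lo (suc len) = begin
  p + sumOver pow2 (integersFrom lo len)     ≤⟨ ℚ.+-monoʳ-≤ p (sumOver-pow2 lo len) ⟩
  p + p                                      ≡⟨ solve 1 (λ x → x :+ x := con 2ℚ :* x) refl p ⟩
  2ℚ * p                                     ≡⟨ pow2-suc (+ len ℤ.- + lo) ⟨
  pow2 (ℤ.suc (+ len ℤ.- + lo))              ≡⟨ cong pow2 (ℤ.+-assoc (+ 1) (+ len) (ℤ.- (+ lo))) ⟨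
  pow2 (+ suc len ℤ.- + lo)                  ∎
  where
  open ℚ.≤-Reasoning
  p = pow2 (+ len ℤ.- + lo)

-- Since exponents decrease along the list, the first one satisfying `P` dominates: all later terms
-- together, even without the test `P`, sum to at most that power. Twice this power is at most 2y.
sumOver-geometric : ∀ (P : ℤ → Bool) y → 0ℚ ≤ y → (∀ e → P e ≡ true → pow2 e ≤ y) → ∀ lo len →
  sumOver (λ e → if P e then pow2 e else 0ℚ) (integersFrom lo len) ≤ 2ℚ * y
sumOver-geometric P y 0≤y P⇒≤y lo zero      = *-nonNeg {2ℚ} {y} (ℕtoℚ-nonNeg 2) 0≤y
sumOver-geometric P y 0≤y P⇒≤y lo (suc len)
  with ih ← sumOver-geometric P y 0≤y P⇒≤y lo len
  with P (+ len ℤ.- + lo) in eq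
... | false = ℚ.≤-trans (ℚ.≤-reflexive (ℚ.+-identityˡ _)) ih
... | true  = begin
  p + sumOver (λ e → if P e then pow2 e else 0ℚ) (integersFrom lo len)
    ≤⟨ ℚ.+-monoʳ-≤ p (sumOver-mono _ pow2 (integersFrom lo len) (λ e → if-≤ (P e) (pow2-nonNeg e))) ⟩
  p + sumOver pow2 (integersFrom lo len)     ≤⟨ ℚ.+-monoʳ-≤ p (sumOver-pow2 lo len) ⟩
  p + p                                      ≡⟨ solve 1 (λ x → x :+ x := con 2ℚ :* x) refl p ⟩
  2ℚ * p                                     ≤⟨ *-monoˡ-≤ {2ℚ} (ℕtoℚ-nonNeg 2) (P⇒≤y _ eq) ⟩
  2ℚ * y                                     ∎
  where
  open ℚ.≤-Reasoning
  p = pow2 (+ len ℤ.- + lo)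

-- The rank of an entry is the number of its occurrences further down the list; the tables of 𝒜 grow
-- at the front, so these are the jobs assigned to the same bucket earlier.
sumByRank : (X → X → Bool) → (ℕ → ℕ) → (X → ℚ) → List X → ℚ
sumByRank _==_ d f []       = 0ℚ
sumByRank _==_ d f (x ∷ xs) = ℕtoℚ (d (count (x ==_) xs)) * f x + sumByRank _==_ d f xs

-- A bucket with c entries has the ranks 0, ..., c - 1, so this is the contribution of one whole
-- bucket.
sumBelow : (ℕ → ℕ) → ℕ → ℕ
sumBelow d zero    = 0
sumBelow d (suc c) = d c ℕ.+ sumBelow d c

module _ (_==_ : X → X → Bool) (==-refl : ∀ x → (x == x) ≡ true)
         (==-sound : ∀ x y → (x == y) ≡ true → x ≡ y) where

  sumOver-if-== : ∀ (h : X → ℚ) {x us} → Unique us → x ∈ us →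
    sumOver (λ u → if u == x then h u else 0ℚ) us ≡ h x
  sumOver-if-∉ : ∀ (h : X → ℚ) {x us} → All (λ u → x ≢ u) us →
    sumOver (λ u → if u == x then h u else 0ℚ) us ≡ 0ℚ
  sumOver-if-∉ h [] = refl
  sumOver-if-∉ h {x} {u ∷ us} (x≢u ∷ x∉us) with u == x in eq
  ... | true  = contradiction (sym (==-sound u x eq)) x≢u
  ... | false = trans (ℚ.+-identityˡ _) (sumOver-if-∉ h x∉us)
  sumOver-if-== h {x} {x ∷ us} (x∉us ∷ _) (here refl)
    rewrite ==-refl x | sumOver-if-∉ h x∉us = ℚ.+-identityʳ (h x)
  sumOver-if-== h {x} {u ∷ us} (u∉us ∷ uniq) (there x∈us) with u == x in eq
  ... | true  = contradiction (==-sound u x eq) (All.lookup u∉us x∈us)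
  ... | false = trans (ℚ.+-identityˡ _) (sumOver-if-== h uniq x∈us)

  -- Regroups a table by bucket. A new entry x of rank c changes only the term of the bucket x, from
  -- `sumBelow d c` to `sumBelow d (suc c)`, and the indicator sum over the duplicate-free `us`
  -- picks out exactly this term.
  sumByRank-group : ∀ d (f : X → ℚ) {us} → Unique us → ∀ {xs} → All (_∈ us) xs →
    sumByRank _==_ d f xs ≡ sumOver (λ u → ℕtoℚ (sumBelow d (count (u ==_) xs)) * f u) us
  sumByRank-group d f {us} uniq [] =
    sym (trans (sumOver-cong _ (λ _ → 0ℚ) us (λ u → ℚ.*-zeroˡ (f u))) (sumOver-0 us))
  sumByRank-group d f {us} uniq {x ∷ xs} (x∈us ∷ xs⊆us) = begin
    h x + sumByRank _==_ d f xs
      ≡⟨ cong₂ _+_ (sym (sumOver-if-== h uniq x∈us)) (sumByRank-group d f uniq xs⊆us) ⟩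
    sumOver (λ u → if u == x then h u else 0ℚ) us + sumOver (λ u → term xs u) us
      ≡⟨ sumOver-+ (λ u → if u == x then h u else 0ℚ) (term xs) us ⟨
    sumOver (λ u → (if u == x then h u else 0ℚ) + term xs u) us
      ≡⟨ sumOver-cong _ (term (x ∷ xs)) us split ⟩
    sumOver (term (x ∷ xs)) us ∎
    where
    open ≡-Reasoning
    h : X → ℚ
    h u = ℕtoℚ (d (count (u ==_) xs)) * f u
    term : List X → X → ℚ
    term ys u = ℕtoℚ (sumBelow d (count (u ==_) ys)) * f u
    split : ∀ u → (if u == x then h u else 0ℚ) + term xs u ≡ term (x ∷ xs) u
    split u with u == x
    ... | false = ℚ.+-identityˡ (term xs u)
    ... | true  = trans (sym (ℚ.*-distribʳ-+ (f u) (ℕtoℚ (d c)) (ℕtoℚ (sumBelow d c))))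
                        (cong (_* f u) (sym (ℕtoℚ-+ (d c) (sumBelow d c))))
      where c = count (u ==_) xs

  sumByRank-1 : ∀ (f : X → ℚ) xs → sumByRank _==_ (λ _ → 1) f xs ≡ sumOver f xs
  sumByRank-1 f []       = refl
  sumByRank-1 f (x ∷ xs) = cong₂ _+_ (ℚ.*-identityˡ (f x)) (sumByRank-1 f xs)

sumBelow-1 : ∀ c → sumBelow (λ _ → 1) c ≡ c
sumBelow-1 zero    = refl
sumBelow-1 (suc c) = cong suc (sumBelow-1 c)

-- The tests of `rej⁺` and `rej⁻` as 0 or 1, for an entry with c predecessors in its bucket. As k
-- divides 0, the first entry counts for T⁺.
rejected⁺ rejected⁻ : ℕ → ℕ → ℕ
rejected⁺ k c = if does (k ∣? c) then 1 else 0
rejected⁻ k c = if does (k ∣? suc c) then 1 else 0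

-- At a rejection, 1 + c = qk, and the induction hypothesis k s ≤ c < qk gives s < q; so one more
-- rejection still fits.
k*rejections⁻≤ : ∀ k c → k ℕ.* sumBelow (rejected⁻ k) c ℕ.≤ c
k*rejections⁻≤ k zero = ℕ.≤-reflexive (ℕ.*-zeroʳ k)
k*rejections⁻≤ k (suc c) with ih ← k*rejections⁻≤ k c | k ∣? suc c
... | no  _ = ℕ.m≤n⇒m≤1+n ih
... | yes (divides q 1+c≡q*k) = begin
  k ℕ.* suc s   ≤⟨ ℕ.*-monoʳ-≤ k s<q ⟩
  k ℕ.* q       ≡⟨ trans (ℕ.*-comm k q) (sym 1+c≡q*k) ⟩
  suc c         ∎
  where
  open ℕ.≤-Reasoning
  s = sumBelow (rejected⁻ k) c
  s<q : s ℕ.< q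
  s<q = ℕ.*-cancelˡ-< k s q (ℕ.≤-trans (s≤s ih) (ℕ.≤-reflexive (trans 1+c≡q*k (ℕ.*-comm q k))))

-- The first rejection is ahead of its payment by k. Strictness carries the induction: at c = qk, k
-- s < k(1 + q) leaves room for one more rejection.
k*rejections⁺< : ∀ k .{{_ : ℕ.NonZero k}} c → k ℕ.* sumBelow (rejected⁺ k) c ℕ.< c ℕ.+ k
k*rejections⁺< k zero = ℕ.≤-trans (s≤s (ℕ.≤-reflexive (ℕ.*-zeroʳ k))) (ℕ.>-nonZero⁻¹ k)
k*rejections⁺< k (suc c) with ih ← k*rejections⁺< k c | k ∣? c
... | no  _ = ℕ.m≤n⇒m≤1+n ih
... | yes (divides q c≡q*k) = s≤s (begin
  k ℕ.* suc s   ≤⟨ ℕ.*-monoʳ-≤ k s<1+q ⟩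
  k ℕ.* suc q   ≡⟨ k*[1+q]≡c+k ⟩
  c ℕ.+ k       ∎)
  where
  open ℕ.≤-Reasoning
  s = sumBelow (rejected⁺ k) c
  k*[1+q]≡c+k : k ℕ.* suc q ≡ c ℕ.+ k
  k*[1+q]≡c+k = trans (ℕ.*-comm k (suc q)) (trans (ℕ.+-comm k (q ℕ.* k)) (cong (ℕ._+ k) (sym c≡q*k)))
  s<1+q : s ℕ.< suc q
  s<1+q = ℕ.*-cancelˡ-< k s (suc q) (subst (k ℕ.* s ℕ.<_) (sym k*[1+q]≡c+k) ih)

k*rejections⁺≤ : ∀ k .{{_ : ℕ.NonZero k}} c →
  k ℕ.* sumBelow (rejected⁺ k) c ℕ.≤ c ℕ.+ (if 0 ℕ.<ᵇ c then k else 0)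
k*rejections⁺≤ k zero    = ℕ.≤-reflexive (ℕ.*-zeroʳ k)
k*rejections⁺≤ k (suc c) = ℕ.<⇒≤ (k*rejections⁺< k (suc c))

-- Rejections by the tables

module _ (_==_ : X → X → Bool) (==-refl : ∀ x → (x == x) ≡ true)
         (==-sound : ∀ x y → (x == y) ≡ true → x ≡ y) (k : ℕ)
         (f : X → ℚ) (0≤f : ∀ x → 0ℚ ≤ f x) where

  private
    ==-dec : DecidableEquality X
    ==-dec x y with x == y in eq
    ... | true  = yes (==-sound x y eq)
    ... | false = no λ { refl → contradiction (trans (sym eq) (==-refl x)) λ () }

    scale : ∀ m c y → k ℕ.* m ℕ.≤ c → 0ℚ ≤ y → ℕtoℚ k * (ℕtoℚ m * y) ≤ ℕtoℚ c * y
    scale m c y km≤c 0≤y = begin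
      ℕtoℚ k * (ℕtoℚ m * y)   ≡⟨ ℚ.*-assoc (ℕtoℚ k) (ℕtoℚ m) y ⟨
      ℕtoℚ k * ℕtoℚ m * y     ≡⟨ cong (_* y) (ℕtoℚ-* k m) ⟨
      ℕtoℚ (k ℕ.* m) * y      ≤⟨ *-monoʳ-≤ {y} 0≤y (ℕtoℚ-mono-≤ km≤c) ⟩
      ℕtoℚ c * y              ∎
      where open ℚ.≤-Reasoning

    -- Grouping by bucket with every entry counted once, i.e. d = 1.
    sumOver-count : ∀ {us xs} → Unique us → All (_∈ us) xs →
      sumOver (λ u → ℕtoℚ (count (u ==_) xs) * f u) us ≡ sumOver f xs
    sumOver-count {us} {xs} uniq xs⊆us = begin
      sumOver (λ u → ℕtoℚ (count (u ==_) xs) * f u) us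
        ≡⟨ sumOver-cong _ _ us (λ u → cong (λ c → ℕtoℚ c * f u) (sumBelow-1 (count (u ==_) xs))) ⟨
      sumOver (λ u → ℕtoℚ (sumBelow (λ _ → 1) (count (u ==_) xs)) * f u) us
        ≡⟨ sumByRank-group _==_ ==-refl ==-sound (λ _ → 1) f uniq xs⊆us ⟨
      sumByRank _==_ (λ _ → 1) f xs
        ≡⟨ sumByRank-1 _==_ ==-refl ==-sound f xs ⟩
      sumOver f xs ∎
      where open ≡-Reasoning

  -- Each bucket pays for its own rejections, so it suffices to group over the distinct keys that
  -- occur.
  k*sumByRank-rejected⁻ : ∀ xs → ℕtoℚ k * sumByRank _==_ (rejected⁻ k) f xs ≤ sumOver f xs
  k*sumByRank-rejected⁻ xs = begin
    ℕtoℚ k * sumByRank _==_ (rejected⁻ k) f xs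
      ≡⟨ cong (ℕtoℚ k *_) (sumByRank-group _==_ ==-refl ==-sound (rejected⁻ k) f uniq xs⊆us) ⟩
    ℕtoℚ k * sumOver (λ u → ℕtoℚ (s u) * f u) us
      ≡⟨ sumOver-* (ℕtoℚ k) (λ u → ℕtoℚ (s u) * f u) us ⟨
    sumOver (λ u → ℕtoℚ k * (ℕtoℚ (s u) * f u)) us
      ≤⟨ sumOver-mono _ _ us (λ u → scale (s u) (count (u ==_) xs) (f u) (k*rejections⁻≤ k (count (u ==_) xs)) (0≤f u)) ⟩
    sumOver (λ u → ℕtoℚ (count (u ==_) xs) * f u) us
      ≡⟨ sumOver-count uniq xs⊆us ⟩
    sumOver f xs ∎
    where
    open ℚ.≤-Reasoning
    us = deduplicate ==-dec xs
    uniq = deduplicate-! ==-dec xs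
    xs⊆us : All (_∈ us) xs
    xs⊆us = All.tabulate (∈-deduplicate⁺ ==-dec)
    s : X → ℕ
    s u = sumBelow (rejected⁻ k) (count (u ==_) xs)

  -- The second summand collects the first rejections, which their buckets cannot pay for. `us` is
  -- left open so that they can later be summed over a grid that is rectangular in (e, i).
  k*sumByRank-rejected⁺ : .{{ℕ.NonZero k}} → ∀ {us xs} → Unique us → All (_∈ us) xs →
    ℕtoℚ k * sumByRank _==_ (rejected⁺ k) f xs ≤
    sumOver f xs + ℕtoℚ k * sumOver (λ u → if 0 ℕ.<ᵇ count (u ==_) xs then f u else 0ℚ) us
  k*sumByRank-rejected⁺ {us} {xs} uniq xs⊆us = begin
    ℕtoℚ k * sumByRank _==_ (rejected⁺ k) f xs
      ≡⟨ cong (ℕtoℚ k *_) (sumByRank-group _==_ ==-refl ==-sound (rejected⁺ k) f uniq xs⊆us) ⟩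
    ℕtoℚ k * sumOver (λ u → ℕtoℚ (s u) * f u) us
      ≡⟨ sumOver-* (ℕtoℚ k) (λ u → ℕtoℚ (s u) * f u) us ⟨
    sumOver (λ u → ℕtoℚ k * (ℕtoℚ (s u) * f u)) us
      ≤⟨ sumOver-mono _ _ us bound ⟩
    sumOver (λ u → ℕtoℚ (c u) * f u + ℕtoℚ k * first u) us
      ≡⟨ sumOver-+ (λ u → ℕtoℚ (c u) * f u) (λ u → ℕtoℚ k * first u) us ⟩
    sumOver (λ u → ℕtoℚ (c u) * f u) us + sumOver (λ u → ℕtoℚ k * first u) us
      ≡⟨ cong₂ _+_ (sumOver-count uniq xs⊆us) (sumOver-* (ℕtoℚ k) first us) ⟩
    sumOver f xs + ℕtoℚ k * sumOver first us ∎
    where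
    open ℚ.≤-Reasoning
    c s : X → ℕ
    c u = count (u ==_) xs
    s u = sumBelow (rejected⁺ k) (c u)
    first : X → ℚ
    first u = if 0 ℕ.<ᵇ c u then f u else 0ℚ
    distrib : ∀ b c u → ℕtoℚ (c ℕ.+ (if b then k else 0)) * f u ≡
                        ℕtoℚ c * f u + ℕtoℚ k * (if b then f u else 0ℚ)
    distrib true  c u = trans (cong (_* f u) (ℕtoℚ-+ c k)) (ℚ.*-distribʳ-+ (f u) (ℕtoℚ c) (ℕtoℚ k))
    distrib false c u = trans (cong (λ m → ℕtoℚ m * f u) (ℕ.+-identityʳ c))
      (solve 3 (λ a b d → a :* b := a :* b :+ d :* con 0ℚ) refl (ℕtoℚ c) (f u) (ℕtoℚ k))
    bound : ∀ u → ℕtoℚ k * (ℕtoℚ (s u) * f u) ≤ ℕtoℚ (c u) * f u + ℕtoℚ k * first u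
    bound u = ℚ.≤-trans
      (scale (s u) (c u ℕ.+ (if 0 ℕ.<ᵇ c u then k else 0)) (f u) (k*rejections⁺≤ k (c u)) (0≤f u))
      (ℚ.≤-reflexive (distrib (0 ℕ.<ᵇ c u) (c u) u))

count-witness : ∀ {P : X → Bool} {Q : X → Set} {xs} → All Q xs →
  (0 ℕ.<ᵇ count P xs) ≡ true → ∃ λ x → P x ≡ true × Q x
count-witness [] ()
count-witness {P = P} {xs = x ∷ xs} (qx ∷ qxs) pos with P x in eq
... | true  = x , eq , qx
... | false = count-witness qxs pos

-- Finite grids of bucket indices

integersWithin : ℕ → List ℤ
integersWithin N = integersFrom N (suc (N ℕ.+ N))

∈-integersWithin : ∀ N z → ℤ.∣ z ∣ ℕ.≤ N → z ∈ integersWithin N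
∈-integersWithin N z ∣z∣≤N = subst (_∈ integersWithin N) shifted
  (∈-map⁺ (λ a → + a ℤ.- + N) (∈-downFrom⁺ (s≤s (begin
    ℤ.∣ z ℤ.+ + N ∣            ≤⟨ ℤ.∣i+j∣≤∣i∣+∣j∣ z (+ N) ⟩
    ℤ.∣ z ∣ ℕ.+ N              ≤⟨ ℕ.+-monoˡ-≤ N ∣z∣≤N ⟩
    N ℕ.+ N                    ∎))))
  where
  open ℕ.≤-Reasoning
  nonNeg : ∀ z → ℤ.∣ z ∣ ℕ.≤ N → + 0 ℤ.≤ z ℤ.+ + N
  nonNeg (+ n)    _   = ℤ.+≤+ z≤n
  nonNeg -[1+ n ] n<N = subst (+ 0 ℤ.≤_) (sym (ℤ.⊖-≥ n<N)) (ℤ.+≤+ z≤n)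
  shifted : + ℤ.∣ z ℤ.+ + N ∣ ℤ.- + N ≡ z
  shifted = trans (cong (λ y → y ℤ.- + N) (ℤ.0≤i⇒+∣i∣≡i (nonNeg z ∣z∣≤N)))
    (trans (ℤ.+-assoc z (+ N) (ℤ.- (+ N)))
    (trans (cong (λ y → z ℤ.+ y) (ℤ.+-inverseʳ (+ N))) (ℤ.+-identityʳ z)))

integersWithin-unique : ∀ N → Unique (integersWithin N)
integersWithin-unique N =
  map⁺ (λ {x} {y} eq → ℤ.+-injective (∙-cancelʳ (ℤ.- (+ N)) (+ x) (+ y) eq)) (downFrom⁺ (suc (N ℕ.+ N)))

-- The buckets (i, m) of T⁺ are parametrised by (e, i) with e = m − i, as k 2^e / 4 bounds from below the
-- density of the jobs blocking a job of the bucket.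
key-grid : ℕ → List Key⁺
key-grid N = map (λ (e , i) → i , i ℤ.+ e) (cartesianProduct (integersWithin N) (integersWithin N))

key-grid-unique : ∀ N → Unique (key-grid N)
key-grid-unique N = map⁺ inj (cartesianProduct⁺ (integersWithin-unique N) (integersWithin-unique N))
  where
  inj : ∀ {x y : ℤ × ℤ} → (proj₂ x , proj₂ x ℤ.+ proj₁ x) ≡ (proj₂ y , proj₂ y ℤ.+ proj₁ y) → x ≡ y
  inj {e , i} {e' , i'} eq with refl ← cong proj₁ eq = cong (_, i) (∙-cancelˡ i e e' (cong proj₂ eq))

i+[m-i]≡m : ∀ i m → i ℤ.+ (m ℤ.- i) ≡ m
i+[m-i]≡m i m = trans (sym (ℤ.+-assoc i m (ℤ.- i))) (xyx⁻¹≈y i m)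

⊆key-grid : ∀ xs → ∃ λ N → All (_∈ key-grid N) xs
⊆key-grid xs = proj₁ (bound xs) , All.map (member _) (proj₂ (bound xs))
  where
  Within : ℕ → Key⁺ → Set
  Within N (i , m) = ℤ.∣ i ∣ ℕ.≤ N × ℤ.∣ m ℤ.- i ∣ ℕ.≤ N
  bound : ∀ xs → ∃ λ N → All (Within N) xs
  bound [] = 0 , []
  bound ((i , m) ∷ xs) with N , xs≤N ← bound xs =
    -- Adding up all absolute values gives a common bound without maxima.
    ℤ.∣ i ∣ ℕ.+ ℤ.∣ m ℤ.- i ∣ ℕ.+ N ,
    (ℕ.m≤n⇒m≤n+o N (ℕ.m≤m+n ℤ.∣ i ∣ _) , ℕ.m≤n⇒m≤n+o N (ℕ.m≤n+m _ ℤ.∣ i ∣)) ∷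
    All.map (λ (a , b) → ℕ.m≤n⇒m≤o+n _ a , ℕ.m≤n⇒m≤o+n _ b) xs≤N
  member : ∀ N {x} → Within N x → x ∈ key-grid N
  member N {i , m} (i≤N , e≤N) = subst (λ y → (i , y) ∈ key-grid N) (i+[m-i]≡m i m)
    (∈-map⁺ (λ (e , i) → i , i ℤ.+ e)
      (∈-cartesianProduct⁺ (∈-integersWithin N (m ℤ.- i) e≤N) (∈-integersWithin N i i≤N)))

==ℤ-refl : ∀ a → (a ==ℤ a) ≡ true
==ℤ-refl a = dec-true (a ℤ.≟ a) refl

==⁺-refl : ∀ x → (x ==⁺ x) ≡ true
==⁺-refl (a , b) rewrite ==ℤ-refl a | ==ℤ-refl b = refl

==⁻-refl : ∀ x → (x ==⁻ x) ≡ true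
==⁻-refl (a , b , c) rewrite ==ℤ-refl a | ==ℤ-refl b | ==ℤ-refl c = refl

==⁺-sound : ∀ x y → (x ==⁺ y) ≡ true → x ≡ y
==⁺-sound (a , b) (a' , b') eq with a ℤ.≟ a' | b ℤ.≟ b'
... | yes refl | yes refl = refl

==⁻-sound : ∀ x y → (x ==⁻ y) ≡ true → x ≡ y
==⁻-sound (a , b , c) (a' , b' , c') eq with a ℤ.≟ a' | b ℤ.≟ b' | c ℤ.≟ c'
... | yes refl | yes refl | yes refl = refl

-- First jobs of the buckets of T⁺

upper⁺ : Key⁺ → ℚ
upper⁺ (_ , m) = 2ℚ * pow2 m

4ℚ 32ℚ : ℚ
4ℚ = + 4 / 1
32ℚ = + 32 / 1

-- The 4 pays for two roundings in `inD⁺⇒dense`: that of the densities to their classes and that of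
-- α⁺/w to 2^i.
dense : (X → ℚ) → ℕ → ℤ → X → Bool
dense ρ k e a = ℕtoℚ k * pow2 e ℚ.≤ᵇ 4ℚ * ρ a

module _ {J : Set} (jobs : List J) (vol ρ : J → ℚ) (k : ℕ) where

  denseVolume : ℤ → ℚ
  denseVolume e = sumOver (λ a → if dense ρ k e a then vol a else 0ℚ) jobs

  -- `vol` will be the full processing time rather than the remaining one. The condition then
  -- depends on the key alone and, once established, survives all later steps.
  Blocked : Key⁺ → Set
  Blocked (i , m) = pow2 i ≤ denseVolume (m ℤ.- i)

  module _ (0≤vol : ∀ a → 0ℚ ≤ vol a) (0≤ρ : ∀ a → 0ℚ ≤ ρ a)
           (ε : ℚ) (0≤ε : 0ℚ ≤ ε) (εk≡1 : ε * ℕtoℚ k ≡ 1ℚ) where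

    -- The constant 32 is 2 from `upper⁺`, 2 from the geometric sum over i, 2 from the one over e,
    -- and 4 from `dense`.
    sumOver-first-keys : ∀ N {keys} → All Blocked keys →
      sumOver (λ u → if 0 ℕ.<ᵇ count (u ==⁺_) keys then upper⁺ u else 0ℚ) (key-grid N)
        ≤ 32ℚ * ε * sumOver (λ a → vol a * ρ a) jobs
    sumOver-first-keys N {keys} blocked = begin
      sumOver first (key-grid N)
        ≡⟨ trans (sumOver-map first _ (cartesianProduct I I)) (sumOver-× (λ (e , i) → first (i , i ℤ.+ e)) I I) ⟩
      sumOver (λ e → sumOver (λ i → first (i , i ℤ.+ e)) I) I
        ≤⟨ sumOver-mono _ _ I bound-e ⟩
      sumOver (λ e → sumOver (λ a → 4ℚ * vol a * (if dense ρ k e a then pow2 e else 0ℚ)) jobs) I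
        -- With e innermost, each job caps its own exponents, which yields the second geometric sum.
        ≡⟨ sumOver-swap (λ e a → 4ℚ * vol a * (if dense ρ k e a then pow2 e else 0ℚ)) I jobs ⟩
      sumOver (λ a → sumOver (λ e → 4ℚ * vol a * (if dense ρ k e a then pow2 e else 0ℚ)) I) jobs
        ≤⟨ sumOver-mono _ _ jobs bound-a ⟩
      sumOver (λ a → 32ℚ * ε * (vol a * ρ a)) jobs
        ≡⟨ sumOver-* (32ℚ * ε) (λ a → vol a * ρ a) jobs ⟩
      32ℚ * ε * sumOver (λ a → vol a * ρ a) jobs ∎
      where
      open ℚ.≤-Reasoning
      I = integersWithin N
      used : Key⁺ → Bool
      used u = 0 ℕ.<ᵇ count (u ==⁺_) keys
      first : Key⁺ → ℚ
      first u = if used u then upper⁺ u else 0ℚ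

      0≤denseVolume : ∀ e → 0ℚ ≤ denseVolume e
      0≤denseVolume e = sumOver-nonNeg (λ a → if dense ρ k e a then vol a else 0ℚ) jobs
        (λ a → 0≤if (dense ρ k e a) (0≤vol a))

      used⇒blocked : ∀ i m → used (i , m) ≡ true → pow2 i ≤ denseVolume (m ℤ.- i)
      used⇒blocked i m eq with x , ==x , bx ← count-witness {P = (i , m) ==⁺_} blocked eq
        with refl ← ==⁺-sound (i , m) x ==x = bx

      first≡ : ∀ e i → first (i , i ℤ.+ e) ≡ 2ℚ * pow2 e * (if used (i , i ℤ.+ e) then pow2 i else 0ℚ)
      first≡ e i with used (i , i ℤ.+ e)
      ... | true  = trans (cong (2ℚ *_) (pow2-+ i e))
        (solve 2 (λ a b → con 2ℚ :* (a :* b) := con 2ℚ :* b :* a) refl (pow2 i) (pow2 e))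
      ... | false = sym (ℚ.*-zeroʳ (2ℚ * pow2 e))

      vol≡ : ∀ e a → 2ℚ * pow2 e * 2ℚ * (if dense ρ k e a then vol a else 0ℚ)
                     ≡ 4ℚ * vol a * (if dense ρ k e a then pow2 e else 0ℚ)
      vol≡ e a with dense ρ k e a
      ... | true  = solve 2 (λ x y → con 2ℚ :* x :* con 2ℚ :* y := con 4ℚ :* y :* x) refl (pow2 e) (vol a)
      ... | false = solve 2 (λ x y → con 2ℚ :* x :* con 2ℚ :* con 0ℚ := con 4ℚ :* y :* con 0ℚ) refl (pow2 e) (vol a)

      bound-e : ∀ e → sumOver (λ i → first (i , i ℤ.+ e)) I
                      ≤ sumOver (λ a → 4ℚ * vol a * (if dense ρ k e a then pow2 e else 0ℚ)) jobs
      bound-e e = begin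
        sumOver (λ i → first (i , i ℤ.+ e)) I
          ≡⟨ sumOver-cong _ _ I (first≡ e) ⟩
        sumOver (λ i → 2ℚ * pow2 e * (if used (i , i ℤ.+ e) then pow2 i else 0ℚ)) I
          ≡⟨ sumOver-* (2ℚ * pow2 e) (λ i → if used (i , i ℤ.+ e) then pow2 i else 0ℚ) I ⟩
        2ℚ * pow2 e * sumOver (λ i → if used (i , i ℤ.+ e) then pow2 i else 0ℚ) I
          -- On the diagonal m = i + e the index m - i is constantly e, so one volume caps 2^i for
          -- all used i.
          ≤⟨ *-monoˡ-≤ {2ℚ * pow2 e} (*-nonNeg {2ℚ} {pow2 e} (ℕtoℚ-nonNeg 2) (pow2-nonNeg e))
               (sumOver-geometric (λ i → used (i , i ℤ.+ e)) (denseVolume e) (0≤denseVolume e)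
                 (λ i u → subst (λ x → pow2 i ≤ denseVolume x) (xyx⁻¹≈y i e) (used⇒blocked i (i ℤ.+ e) u))
                 N (suc (N ℕ.+ N))) ⟩
        2ℚ * pow2 e * (2ℚ * denseVolume e)
          ≡⟨ ℚ.*-assoc (2ℚ * pow2 e) 2ℚ (denseVolume e) ⟨
        2ℚ * pow2 e * 2ℚ * denseVolume e
          ≡⟨ sumOver-* (2ℚ * pow2 e * 2ℚ) (λ a → if dense ρ k e a then vol a else 0ℚ) jobs ⟨
        sumOver (λ a → 2ℚ * pow2 e * 2ℚ * (if dense ρ k e a then vol a else 0ℚ)) jobs
          ≡⟨ sumOver-cong _ _ jobs (vol≡ e) ⟩
        sumOver (λ a → 4ℚ * vol a * (if dense ρ k e a then pow2 e else 0ℚ)) jobs ∎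

      dense⇒ : ∀ a e → dense ρ k e a ≡ true → pow2 e ≤ ε * (4ℚ * ρ a)
      dense⇒ a e eq = begin
        pow2 e                     ≡⟨ ℚ.*-identityˡ (pow2 e) ⟨
        1ℚ * pow2 e                ≡⟨ cong (_* pow2 e) εk≡1 ⟨
        ε * ℕtoℚ k * pow2 e        ≡⟨ ℚ.*-assoc ε (ℕtoℚ k) (pow2 e) ⟩
        ε * (ℕtoℚ k * pow2 e)      ≤⟨ *-monoˡ-≤ {ε} 0≤ε (ℚ.≤ᵇ⇒≤ (Equivalence.from T-≡ eq)) ⟩
        ε * (4ℚ * ρ a)             ∎

      bound-a : ∀ a → sumOver (λ e → 4ℚ * vol a * (if dense ρ k e a then pow2 e else 0ℚ)) I
                      ≤ 32ℚ * ε * (vol a * ρ a)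
      bound-a a = begin
        sumOver (λ e → 4ℚ * vol a * (if dense ρ k e a then pow2 e else 0ℚ)) I
          ≡⟨ sumOver-* (4ℚ * vol a) (λ e → if dense ρ k e a then pow2 e else 0ℚ) I ⟩
        4ℚ * vol a * sumOver (λ e → if dense ρ k e a then pow2 e else 0ℚ) I
          ≤⟨ *-monoˡ-≤ {4ℚ * vol a} (*-nonNeg {4ℚ} {vol a} (ℕtoℚ-nonNeg 4) (0≤vol a))
               (sumOver-geometric (λ e → dense ρ k e a) (ε * (4ℚ * ρ a))
                 (*-nonNeg {ε} {4ℚ * ρ a} 0≤ε (*-nonNeg {4ℚ} {ρ a} (ℕtoℚ-nonNeg 4) (0≤ρ a)))
                 (dense⇒ a) N (suc (N ℕ.+ N))) ⟩
        4ℚ * vol a * (2ℚ * (ε * (4ℚ * ρ a)))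
          ≡⟨ solve 3 (λ v d x → con 4ℚ :* v :* (con 2ℚ :* (x :* (con 4ℚ :* d))) := con 32ℚ :* x :* (v :* d)) refl (vol a) (ρ a) ε ⟩
        32ℚ * ε * (vol a * ρ a) ∎

-- Runs of 𝒜

⊘-* : ∀ x q → Positive q → (x ⊘ q) * q ≡ x
⊘-* x q@(mkℚ +[1+ _ ] _ _) _ =
  trans (ℚ.*-assoc x (ℚ.1/ q) q) (trans (cong (x *_) (ℚ.*-inverseˡ q)) (ℚ.*-identityʳ x))

0<-⊘ : ∀ x q → Positive x → Positive q → Positive (x ⊘ q)
0<-⊘ x q 0<x 0<q = ℚ.positive {x ⊘ q} (ℚ.*-cancelʳ-<-nonNeg q {{ℚ.pos⇒nonNeg q {{0<q}}}} {0ℚ} {x ⊘ q}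
  (subst₂ ℚ._<_ (sym (ℚ.*-zeroˡ q)) (sym (⊘-* x q 0<q)) (ℚ.positive⁻¹ x {{0<x}})))

pos⇒0≤ : ∀ {x} → Positive x → 0ℚ ≤ x
pos⇒0≤ {x} 0<x = ℚ.<⇒≤ (ℚ.positive⁻¹ x {{0<x}})

≰ᵇ⇒≥ : ∀ x y → (x ℚ.≤ᵇ y) ≡ false → y ≤ x
≰ᵇ⇒≥ x y x≰ᵇy = ℚ.<⇒≤ (ℚ.≰⇒> λ x≤y →
  contradiction (trans (sym (Equivalence.to T-≡ (ℚ.≤⇒≤ᵇ x≤y))) x≰ᵇy) λ ())

-- One arrival: `b` says whether the job is assigned to the table. Its rank as the new head is the
-- very count tested for rejection, so a rejected weight v is matched by a new summand f x ≥ v.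
sumByRank-insert : ∀ (_==_ : X → X → Bool) (hit : ℕ → Bool) (f : X → ℚ) b x xs v → v ≤ f x →
  sumByRank _==_ (λ c → if hit c then 1 else 0) f xs + (if b ∧ hit (count (x ==_) xs) then v else 0ℚ)
    ≤ sumByRank _==_ (λ c → if hit c then 1 else 0) f (if b then x ∷ xs else xs)
sumByRank-insert _==_ hit f false x xs v v≤fx = ℚ.≤-reflexive (ℚ.+-identityʳ _)
sumByRank-insert _==_ hit f true  x xs v v≤fx with hit (count (x ==_) xs)
... | false = ℚ.≤-reflexive (solve 2 (λ s y → s :+ con 0ℚ := con 0ℚ :* y :+ s) refl s (f x))
  where s = sumByRank _==_ (λ c → if hit c then 1 else 0) f xs
... | true  = ℚ.≤-trans (ℚ.+-monoʳ-≤ s v≤fx)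
  (ℚ.≤-reflexive (solve 2 (λ s y → s :+ y := con 1ℚ :* y :+ s) refl s (f x)))
  where s = sumByRank _==_ (λ c → if hit c then 1 else 0) f xs

sumOver-insert : ∀ (f : X → ℚ) b x xs v → f x ≤ v → 0ℚ ≤ v →
  sumOver f (if b then x ∷ xs else xs) ≤ sumOver f xs + v
sumOver-insert f true  x xs v fx≤v _   =
  ℚ.≤-trans (ℚ.+-monoˡ-≤ (sumOver f xs) fx≤v) (ℚ.≤-reflexive (ℚ.+-comm v (sumOver f xs)))
sumOver-insert f false x xs v _    0≤v =
  ℚ.≤-trans (ℚ.≤-reflexive (sym (ℚ.+-identityʳ (sumOver f xs)))) (ℚ.+-monoʳ-≤ (sumOver f xs) 0≤v)

All-insert : ∀ {Q : X → Set} b {x xs} → (b ≡ true → Q x) → All Q xs → All Q (if b then x ∷ xs else xs)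
All-insert true  qx qxs = qx refl ∷ qxs
All-insert false qx qxs = qxs

if-∨-≤ : ∀ a b {v} → 0ℚ ≤ v → (if a ∨ b then v else 0ℚ) ≤ (if a then v else 0ℚ) + (if b then v else 0ℚ)
if-∨-≤ true  true  {v} 0≤v = ℚ.≤-trans (ℚ.≤-reflexive (sym (ℚ.+-identityʳ v))) (ℚ.+-monoʳ-≤ v 0≤v)
if-∨-≤ true  false {v} 0≤v = ℚ.≤-reflexive (sym (ℚ.+-identityʳ v))
if-∨-≤ false b     {v} 0≤v = ℚ.≤-reflexive (sym (ℚ.+-identityˡ _))

if-upd-≤ : ∀ c b f {v} → 0ℚ ≤ v →
  (if (if c then b else f) then v else 0ℚ) ≤ (if f then v else 0ℚ) + (if c then (if b then v else 0ℚ) else 0ℚ)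
if-upd-≤ false b     f         0≤v = ℚ.≤-reflexive (sym (ℚ.+-identityʳ _))
if-upd-≤ true  b     false     0≤v = ℚ.≤-reflexive (sym (ℚ.+-identityˡ _))
if-upd-≤ true  true  true  {v} 0≤v = ℚ.≤-trans (ℚ.≤-reflexive (sym (ℚ.+-identityʳ v))) (ℚ.+-monoʳ-≤ v 0≤v)
if-upd-≤ true  false true  {v} 0≤v = ℚ.≤-trans 0≤v (ℚ.≤-reflexive (sym (ℚ.+-identityʳ v)))

if-<ᵇsuc : ∀ r t v → (if r ℕ.<ᵇ t then v else 0ℚ) + (if r ℕ.≡ᵇ t then v else 0ℚ) ≡ (if r ℕ.<ᵇ suc t then v else 0ℚ)
if-<ᵇsuc zero    zero    v = ℚ.+-identityˡ v
if-<ᵇsuc zero    (suc t) v = ℚ.+-identityʳ v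
if-<ᵇsuc (suc r) zero    v = ℚ.+-identityˡ 0ℚ
if-<ᵇsuc (suc r) (suc t) v = if-<ᵇsuc r t v

≤ᵇ≡<ᵇsuc : ∀ m n → (m ℕ.≤ᵇ n) ≡ (m ℕ.<ᵇ suc n)
≤ᵇ≡<ᵇsuc zero    n = refl
≤ᵇ≡<ᵇsuc (suc m) n = refl

if-interval : ∀ r {a t} v → a ℕ.≤ t →
  (if r ℕ.<ᵇ suc a then v else 0ℚ) + (if (a ℕ.<ᵇ r) ∧ (r ℕ.≤ᵇ t) then v else 0ℚ) ≡ (if r ℕ.<ᵇ suc t then v else 0ℚ)
if-interval r {a} {t} v a≤t with r ℕ.≤? a
... | yes r≤a
  rewrite dec-true (r ℕ.<? suc a) (s≤s r≤a) | dec-false (a ℕ.<? r) (ℕ.≤⇒≯ r≤a)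
        | dec-true (r ℕ.<? suc t) (s≤s (ℕ.≤-trans r≤a a≤t)) = ℚ.+-identityʳ v
... | no r≰a
  rewrite dec-false (r ℕ.<? suc a) (λ r<1+a → r≰a (ℕ.s≤s⁻¹ r<1+a)) | dec-true (a ℕ.<? r) (ℕ.≰⇒> r≰a)
        | ≤ᵇ≡<ᵇsuc r t = ℚ.+-identityˡ _

-- In both parts of α⁺ a job of D⁺ contributes at most w_j times its remaining volume: the
-- remaining weights of the second part satisfy p_j ρ_a ≤ p_j ρ_j = w_j.
volume-bound : ∀ (a d l b : Bool) (w p rem vol ρₐ ρ : ℚ) → 0ℚ ≤ w → 0ℚ ≤ p → 0ℚ ≤ rem → 0ℚ ≤ vol →
  rem ≤ vol → ρ * p ≡ w → (d ≡ true → b ≡ true) → (l ≡ false → ρₐ ≤ ρ) →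
  w * (if a ∧ d ∧ l then rem else 0ℚ) + p * (if a ∧ d ∧ not l then ρₐ * rem else 0ℚ)
    ≤ w * (if b then vol else 0ℚ)
volume-bound a d l b w p rem vol ρₐ ρ 0≤w 0≤p 0≤rem 0≤vol rem≤vol ρp≡w d⇒b ρₐ≤ρ = go a d l b d⇒b ρₐ≤ρ
  where
  open ℚ.≤-Reasoning
  outside : ∀ b → w * 0ℚ + p * 0ℚ ≤ w * (if b then vol else 0ℚ)
  outside false = ℚ.≤-reflexive (solve 2 (λ x y → x :* con 0ℚ :+ y :* con 0ℚ := x :* con 0ℚ) refl w p)
  outside true  = ℚ.≤-trans
    (ℚ.≤-reflexive (solve 2 (λ x y → x :* con 0ℚ :+ y :* con 0ℚ := con 0ℚ) refl w p))
    (*-nonNeg {w} {vol} 0≤w 0≤vol)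
  go : ∀ a d l b → (d ≡ true → b ≡ true) → (l ≡ false → ρₐ ≤ ρ) →
    w * (if a ∧ d ∧ l then rem else 0ℚ) + p * (if a ∧ d ∧ not l then ρₐ * rem else 0ℚ)
      ≤ w * (if b then vol else 0ℚ)
  go false d     l b _   _ = outside b
  go true  false l b _   _ = outside b
  go true  true  l false d⇒b _ = contradiction (d⇒b refl) λ ()
  go true  true  true true _ _ = begin
    w * rem + p * 0ℚ        ≡⟨ solve 3 (λ x y z → x :* z :+ y :* con 0ℚ := x :* z) refl w p rem ⟩
    w * rem                 ≤⟨ *-monoˡ-≤ {w} 0≤w rem≤vol ⟩
    w * vol                 ∎
  go true  true  false true _ ρₐ≤ρ = begin
    w * 0ℚ + p * (ρₐ * rem)
      ≡⟨ solve 4 (λ x y z u → x :* con 0ℚ :+ y :* (z :* u) := z :* (y :* u)) refl w p ρₐ rem ⟩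
    ρₐ * (p * rem)          ≤⟨ *-monoʳ-≤ {p * rem} (*-nonNeg {p} {rem} 0≤p 0≤rem) (ρₐ≤ρ refl) ⟩
    ρ * (p * rem)           ≡⟨ ℚ.*-assoc ρ p rem ⟨
    ρ * p * rem             ≡⟨ cong (_* rem) ρp≡w ⟩
    w * rem                 ≤⟨ *-monoˡ-≤ {w} 0≤w rem≤vol ⟩
    w * vol                 ∎

-- Rejected jobs are charged the `upper` value of their bucket while its members pay the `lower`
-- value. The ratio is 2 for T⁺, where the weight class is part of the key, and 4 for T⁻, where w =
-- ρ p is rounded in both factors.
lower⁺ : Key⁺ → ℚ
lower⁺ (_ , m) = pow2 m

lower⁻ : Key⁻ → ℚ
lower⁻ (_ , c , b) = pow2 c * pow2 b

upper⁻ : Key⁻ → ℚ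
upper⁻ u = 4ℚ * lower⁻ u

module Rejections (ε : ℚ) (k : ℕ) .{{_ : ℕ.NonZero k}} (0≤ε : 0ℚ ≤ ε) (εk≡1 : ε * ℕtoℚ k ≡ 1ℚ)
  {n : ℕ} (r p : Fin n → ℕ) (w : Fin n → ℚ)
  (0<p : ∀ j → 0 ℕ.< p j) (0<w : ∀ j → Positive (w j)) where

  open Alg k r p w hiding (ℕtoℚ)

  0≤w : ∀ j → 0ℚ ≤ w j
  0≤w j = pos⇒0≤ (0<w j)

  0<pℚ : ∀ j → Positive (pℚ j)
  0<pℚ j = ℕtoℚ-pos (p j) {{ℕ.>-nonZero (0<p j)}}

  0<ρ : ∀ j → Positive (ρ j)
  0<ρ j = 0<-⊘ (w j) (pℚ j) (0<w j) (0<pℚ j)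

  ρp≡w : ∀ j → ρ j * pℚ j ≡ w j
  ρp≡w j = ⊘-* (w j) (pℚ j) (0<pℚ j)

  -- Jobs assigned to T⁺ are blocked by dense volume

  V : ℤ → ℚ
  V = denseVolume (allFin n) pℚ ρ k

  IsBlocked : Key⁺ → Set
  IsBlocked = Blocked (allFin n) pℚ ρ k

  module _ (t : ℕ) (j : Fin n) (s : State) (rem≤p : ∀ i → rem s i ℕ.≤ p i)
           (assigned : toT⁺ t j s ≡ true) where

    private
      x = α⁺ t j s ⊘ w j
      i = ⌊ x ⌋₂
      m = ⌊ w j ⌋₂
      e = m ℤ.- i

    pk≤x : pℚ j * kℚ ≤ x
    pk≤x = ℚ.*-cancelˡ-≤-pos (w j) {{0<w j}} (begin
      w j * (pℚ j * kℚ)   ≡⟨ ℚ.*-assoc (w j) (pℚ j) kℚ ⟨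
      thr j               ≤⟨ ℚ.≤ᵇ⇒≤ (Equivalence.from T-≡ assigned) ⟩
      α⁺ t j s            ≡⟨ ⊘-* (α⁺ t j s) (w j) (0<w j) ⟨
      x * w j             ≡⟨ ℚ.*-comm x (w j) ⟩
      w j * x             ∎)
      where open ℚ.≤-Reasoning

    0<x : Positive x
    0<x = ℚ.positive (ℚ.<-≤-trans (ℚ.positive⁻¹ (pℚ j * kℚ)
      {{ℚ.pos*pos⇒pos (pℚ j) {{0<pℚ j}} kℚ {{ℕtoℚ-pos k}}}}) pk≤x)

    -- The threshold of T⁺ gives k 2^m ≤ k w_j = ρ_j p_j k ≤ ρ_j x. Rounding x to 2^i costs a factor
    -- 2, and passing from ρ_j to ρ_a by their classes another.
    inD⁺⇒dense : ∀ a → inD⁺ j a ≡ true → kℚ * pow2 e ≤ 4ℚ * ρ a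
    inD⁺⇒dense a a∈D⁺ = ℚ.*-cancelʳ-≤-pos (pow2 i) {{pow2-pos i}} (begin
      kℚ * pow2 e * pow2 i       ≡⟨ ℚ.*-assoc kℚ (pow2 e) (pow2 i) ⟩
      kℚ * (pow2 e * pow2 i)     ≡⟨ cong (kℚ *_) (trans (ℚ.*-comm (pow2 e) (pow2 i)) (sym (pow2-+ i e))) ⟩
      kℚ * pow2 (i ℤ.+ e)        ≡⟨ cong (λ y → kℚ * pow2 y) (i+[m-i]≡m i m) ⟩
      kℚ * pow2 m                ≤⟨ *-monoˡ-≤ {kℚ} (ℕtoℚ-nonNeg k) (proj₁ (⌊⌋₂-bounds (w j) (0<w j))) ⟩
      kℚ * w j                   ≡⟨ cong (kℚ *_) (ρp≡w j) ⟨
      kℚ * (ρ j * pℚ j)          ≡⟨ solve 3 (λ a b c → a :* (b :* c) := b :* (c :* a)) refl kℚ (ρ j) (pℚ j) ⟩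
      ρ j * (pℚ j * kℚ)          ≤⟨ *-monoˡ-≤ {ρ j} (pos⇒0≤ (0<ρ j)) pk≤x ⟩
      ρ j * x                    ≤⟨ *-monoˡ-≤ {ρ j} (pos⇒0≤ (0<ρ j)) (proj₂ (⌊⌋₂-bounds x 0<x)) ⟩
      ρ j * (2ℚ * pow2 i)        ≤⟨ *-monoʳ-≤ {2ℚ * pow2 i} 0≤2pow2 ρj≤2ρa ⟩
      2ℚ * ρ a * (2ℚ * pow2 i)   ≡⟨ solve 2 (λ a b → con 2ℚ :* a :* (con 2ℚ :* b) := con 4ℚ :* a :* b) refl (ρ a) (pow2 i) ⟩
      4ℚ * ρ a * pow2 i          ∎)
      where
      open ℚ.≤-Reasoning
      0≤2pow2 : 0ℚ ≤ 2ℚ * pow2 i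
      0≤2pow2 = *-nonNeg {2ℚ} {pow2 i} (ℕtoℚ-nonNeg 2) (pow2-nonNeg i)
      ρj≤2ρa : ρ j ≤ 2ℚ * ρ a
      ρj≤2ρa = begin
        ρ j                    ≤⟨ proj₂ (⌊⌋₂-bounds (ρ j) (0<ρ j)) ⟩
        2ℚ * pow2 ⌊ ρ j ⌋₂     ≤⟨ *-monoˡ-≤ {2ℚ} (ℕtoℚ-nonNeg 2) (pow2-mono-≤ {⌊ ρ j ⌋₂} {⌊ ρ a ⌋₂} (ℤ.≤ᵇ⇒≤ (Equivalence.from T-≡ a∈D⁺))) ⟩
        2ℚ * pow2 ⌊ ρ a ⌋₂     ≤⟨ *-monoˡ-≤ {2ℚ} (ℕtoℚ-nonNeg 2) (proj₁ (⌊⌋₂-bounds (ρ a) (0<ρ a))) ⟩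
        2ℚ * ρ a               ∎

    -- Both halves of α⁺ merge into one sum over jobs; then the active jobs of D⁺ are enlarged to
    -- all dense jobs of the instance.
    α⁺≤w*V : α⁺ t j s ≤ w j * V e
    α⁺≤w*V = begin
      w j * ∑If P₁ remℚ + pℚ j * ∑If P₂ (wrem s)
        ≡⟨ cong₂ _+_ (sumOver-* (w j) f₁ (allFin n)) (sumOver-* (pℚ j) f₂ (allFin n)) ⟨
      ∑ (λ a → w j * f₁ a) + ∑ (λ a → pℚ j * f₂ a)
        ≡⟨ sumOver-+ (λ a → w j * f₁ a) (λ a → pℚ j * f₂ a) (allFin n) ⟨
      ∑ (λ a → w j * f₁ a + pℚ j * f₂ a)
        ≤⟨ sumOver-mono _ _ (allFin n) pointwise ⟩
      ∑ (λ a → w j * (if dense ρ k e a then pℚ a else 0ℚ))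
        ≡⟨ sumOver-* (w j) (λ a → if dense ρ k e a then pℚ a else 0ℚ) (allFin n) ⟩
      w j * V e ∎
      where
      open ℚ.≤-Reasoning
      remℚ : Fin n → ℚ
      remℚ a = ℕtoℚ (rem s a)
      P₁ P₂ : Fin n → Bool
      P₁ a = inA t j s a ∧ inD⁺ j a ∧ (ρ j ℚ.≤ᵇ ρ a)
      P₂ a = inA t j s a ∧ inD⁺ j a ∧ (ρ a <ᵇℚ ρ j)
      f₁ f₂ : Fin n → ℚ
      f₁ a = if P₁ a then remℚ a else 0ℚ
      f₂ a = if P₂ a then wrem s a else 0ℚ
      dense-true : ∀ a → inD⁺ j a ≡ true → dense ρ k e a ≡ true
      dense-true a a∈D⁺ = Equivalence.to T-≡ (ℚ.≤⇒≤ᵇ (inD⁺⇒dense a a∈D⁺))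
      pointwise : ∀ a → w j * f₁ a + pℚ j * f₂ a ≤ w j * (if dense ρ k e a then pℚ a else 0ℚ)
      pointwise a = volume-bound (inA t j s a) (inD⁺ j a) (ρ j ℚ.≤ᵇ ρ a) (dense ρ k e a)
        (w j) (pℚ j) (remℚ a) (pℚ a) (ρ a) (ρ j) (0≤w j) (ℕtoℚ-nonNeg (p j)) (ℕtoℚ-nonNeg (rem s a))
        (ℕtoℚ-nonNeg (p a)) (ℕtoℚ-mono-≤ (rem≤p a)) (ρp≡w j) (dense-true a) (≰ᵇ⇒≥ (ρ j) (ρ a))

    key⁺-blocked : IsBlocked (key⁺ t j s)
    key⁺-blocked = ℚ.≤-trans (proj₁ (⌊⌋₂-bounds x 0<x)) (ℚ.*-cancelˡ-≤-pos (w j) {{0<w j}} (begin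
      w j * x       ≡⟨ ℚ.*-comm (w j) x ⟩
      x * w j       ≡⟨ ⊘-* (α⁺ t j s) (w j) (0<w j) ⟩
      α⁺ t j s      ≤⟨ α⁺≤w*V ⟩
      w j * V e     ∎))
      where open ℚ.≤-Reasoning

  -- Weight released over time

  before : ℕ → ℚ
  before t = ∑If (λ i → r i ℕ.<ᵇ t) w

  before-suc : ∀ t → before t + ∑If (λ i → r i ℕ.≡ᵇ t) w ≡ before (suc t)
  before-suc t = trans
    (sym (sumOver-+ (λ i → if r i ℕ.<ᵇ t then w i else 0ℚ) (λ i → if r i ℕ.≡ᵇ t then w i else 0ℚ) (allFin n)))
    (sumOver-cong _ _ (allFin n) (λ i → if-<ᵇsuc (r i) t (w i)))

  before+arrivedW : ∀ {a t} → a ℕ.≤ t → before (suc a) + arrivedW a t ≡ before (suc t)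
  before+arrivedW {a} {t} a≤t = trans
    (sym (sumOver-+ (λ i → if r i ℕ.<ᵇ suc a then w i else 0ℚ)
                    (λ i → if (a ℕ.<ᵇ r i) ∧ (r i ℕ.≤ᵇ t) then w i else 0ℚ) (allFin n)))
    (sumOver-cong _ _ (allFin n) (λ i → if-interval (r i) (w i) a≤t))

  0≤∑If : ∀ P → 0ℚ ≤ ∑If P w
  0≤∑If P = sumOver-nonNeg (λ i → if P i then w i else 0ℚ) (allFin n) (λ i → 0≤if (P i) (0≤w i))

  ∑If≤totalW : ∀ P → ∑If P w ≤ totalW
  ∑If≤totalW P = sumOver-mono (λ i → if P i then w i else 0ℚ) w (allFin n) (λ i → if-≤ (P i) (0≤w i))

  before-mono-suc : ∀ t → before t ≤ before (suc t)
  before-mono-suc t = ℚ.≤-trans (ℚ.≤-reflexive (sym (ℚ.+-identityʳ (before t))))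
    (ℚ.≤-trans (ℚ.+-monoʳ-≤ (before t) (0≤∑If (λ i → r i ℕ.≡ᵇ t))) (ℚ.≤-reflexive (before-suc t)))

  -- Only an upper bound: a flag that was already set is counted again, so no freshness of j has to
  -- be tracked.
  ∑If-upd : ∀ f j b → ∑If (upd f j b) w ≤ ∑If f w + (if b then w j else 0ℚ)
  ∑If-upd f j b = begin
    ∑If (upd f j b) w
      ≤⟨ sumOver-mono _ _ (allFin n) (λ i → if-upd-≤ (does (i Fin.≟ j)) b (f i) (0≤w i)) ⟩
    ∑ (λ i → (if f i then w i else 0ℚ) + (if does (i Fin.≟ j) then h i else 0ℚ))
      ≡⟨ sumOver-+ (λ i → if f i then w i else 0ℚ) (λ i → if does (i Fin.≟ j) then h i else 0ℚ) (allFin n) ⟩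
    ∑If f w + ∑ (λ i → if does (i Fin.≟ j) then h i else 0ℚ)
      ≡⟨ cong (λ y → ∑If f w + y) (sumOver-if-== (λ i i' → does (i Fin.≟ i')) (λ i → dec-true (i Fin.≟ i) refl)
           sound h (allFin⁺ n) (∈-allFin j)) ⟩
    ∑If f w + h j ∎
    where
    open ℚ.≤-Reasoning
    h : Fin n → ℚ
    h i = if b then w i else 0ℚ
    sound : ∀ i i' → does (i Fin.≟ i') ≡ true → i ≡ i'
    sound i i' eq with i Fin.≟ i'
    ... | yes i≡i' = i≡i'

  -- Rejected weight as recorded by the tables

  cost⁺ : List Key⁺ → ℚ
  cost⁺ = sumByRank _==⁺_ (rejected⁺ k) upper⁺

  cost⁻ : List Key⁻ → ℚ
  cost⁻ = sumByRank _==⁻_ (rejected⁻ k) upper⁻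

  lower⁺≤w : ∀ t j s → lower⁺ (key⁺ t j s) ≤ w j
  lower⁺≤w t j s = proj₁ (⌊⌋₂-bounds (w j) (0<w j))

  w≤upper⁺ : ∀ t j s → w j ≤ upper⁺ (key⁺ t j s)
  w≤upper⁺ t j s = proj₂ (⌊⌋₂-bounds (w j) (0<w j))

  lower⁻≤w : ∀ t j s → lower⁻ (key⁻ t j s) ≤ w j
  lower⁻≤w t j s = begin
    pow2 ⌊ ρ j ⌋₂ * pow2 ⌊ pℚ j ⌋₂   ≤⟨ *-monoʳ-≤ {pow2 ⌊ pℚ j ⌋₂} (pow2-nonNeg ⌊ pℚ j ⌋₂) (proj₁ (⌊⌋₂-bounds (ρ j) (0<ρ j))) ⟩
    ρ j * pow2 ⌊ pℚ j ⌋₂             ≤⟨ *-monoˡ-≤ {ρ j} (pos⇒0≤ (0<ρ j)) (proj₁ (⌊⌋₂-bounds (pℚ j) (0<pℚ j))) ⟩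
    ρ j * pℚ j                       ≡⟨ ρp≡w j ⟩
    w j                              ∎
    where open ℚ.≤-Reasoning

  w≤upper⁻ : ∀ t j s → w j ≤ upper⁻ (key⁻ t j s)
  w≤upper⁻ t j s = begin
    w j                            ≡⟨ ρp≡w j ⟨
    ρ j * pℚ j                     ≤⟨ *-monoˡ-≤ {ρ j} (pos⇒0≤ (0<ρ j)) (proj₂ (⌊⌋₂-bounds (pℚ j) (0<pℚ j))) ⟩
    ρ j * (2ℚ * b)                 ≤⟨ *-monoʳ-≤ {2ℚ * b} (*-nonNeg {2ℚ} {b} (ℕtoℚ-nonNeg 2) (pow2-nonNeg ⌊ pℚ j ⌋₂))
                                        (proj₂ (⌊⌋₂-bounds (ρ j) (0<ρ j))) ⟩
    2ℚ * a * (2ℚ * b)              ≡⟨ solve 2 (λ a b → con 2ℚ :* a :* (con 2ℚ :* b) := con 4ℚ :* (a :* b)) refl a b ⟩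
    4ℚ * (a * b)                   ∎
    where
    open ℚ.≤-Reasoning
    a = pow2 ⌊ ρ j ⌋₂
    b = pow2 ⌊ pℚ j ⌋₂

  -- `y` is the weight of the arrivals treated so far, `before t` between steps. Table entries are
  -- paid for at their `lower` values by the weights of the arriving jobs. `cost⁺` and `cost⁻`
  -- charge the entries whose rank marks them as rejected at their `upper` values, which bounds the
  -- rejected weight by the tables alone.
  record TableInvariant (y : ℚ) (s : State) : Set where
    field
      rem≤p     : ∀ i → rem s i ℕ.≤ p i
      blocked   : All IsBlocked (T⁺ s)
      rejW≤cost : rejW s ≤ cost⁺ (T⁺ s) + cost⁻ (T⁻ s)
      charge⁺   : sumOver lower⁺ (T⁺ s) ≤ y
      charge⁻   : sumOver lower⁻ (T⁻ s) ≤ y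
  open TableInvariant

  arrive-table : ∀ t j {y s} → TableInvariant y s → TableInvariant (y + w j) (arrive t j s)
  arrive-table t j {y} {s} inv = record
    { rem≤p     = rem≤p inv
    ; blocked   = All-insert (toT⁺ t j s) (key⁺-blocked t j s (rem≤p inv)) (blocked inv)
    ; rejW≤cost = begin
        ∑If (upd (rej s) j (rej⁺ t j s ∨ rej⁻ t j s)) w
          ≤⟨ ∑If-upd (rej s) j (rej⁺ t j s ∨ rej⁻ t j s) ⟩
        -- A job rejected by both tables is paid for in both.
        rejW s + (if rej⁺ t j s ∨ rej⁻ t j s then w j else 0ℚ)
          ≤⟨ ℚ.+-mono-≤ (rejW≤cost inv) (if-∨-≤ (rej⁺ t j s) (rej⁻ t j s) (0≤w j)) ⟩
        cost⁺ (T⁺ s) + cost⁻ (T⁻ s) + (w⁺ + w⁻)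
          ≡⟨ solve 4 (λ a b c d → a :+ b :+ (c :+ d) := a :+ c :+ (b :+ d)) refl
               (cost⁺ (T⁺ s)) (cost⁻ (T⁻ s)) w⁺ w⁻ ⟩
        cost⁺ (T⁺ s) + w⁺ + (cost⁻ (T⁻ s) + w⁻)
          ≤⟨ ℚ.+-mono-≤
               (sumByRank-insert _==⁺_ (λ c → does (k ∣? c)) upper⁺ (toT⁺ t j s) (key⁺ t j s) (T⁺ s) (w j) (w≤upper⁺ t j s))
               (sumByRank-insert _==⁻_ (λ c → does (k ∣? suc c)) upper⁻ (toT⁻ t j s) (key⁻ t j s) (T⁻ s) (w j) (w≤upper⁻ t j s)) ⟩
        cost⁺ (T⁺ (arrive t j s)) + cost⁻ (T⁻ (arrive t j s)) ∎
    ; charge⁺   = ℚ.≤-trans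
        (sumOver-insert lower⁺ (toT⁺ t j s) (key⁺ t j s) (T⁺ s) (w j) (lower⁺≤w t j s) (0≤w j))
        (ℚ.+-monoˡ-≤ (w j) (charge⁺ inv))
    ; charge⁻   = ℚ.≤-trans
        (sumOver-insert lower⁻ (toT⁻ t j s) (key⁻ t j s) (T⁻ s) (w j) (lower⁻≤w t j s) (0≤w j))
        (ℚ.+-monoˡ-≤ (w j) (charge⁻ inv))
    }
    where
    open ℚ.≤-Reasoning
    w⁺ w⁻ : ℚ
    w⁺ = if rej⁺ t j s then w j else 0ℚ
    w⁻ = if rej⁻ t j s then w j else 0ℚ

  arriveIf : ℕ → State → Fin n → State
  arriveIf t s j = if r j ℕ.≡ᵇ t then arrive t j s else s

  arriveIf-table : ∀ t js {y s} → TableInvariant y s →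
    TableInvariant (y + sumOver (λ j → if r j ℕ.≡ᵇ t then w j else 0ℚ) js) (foldl (arriveIf t) s js)
  arriveIf-table t []       {y} {s} inv = subst (λ x → TableInvariant x s) (sym (ℚ.+-identityʳ y)) inv
  arriveIf-table t (j ∷ js) {y} {s} inv =
    subst (λ x → TableInvariant x (foldl (arriveIf t) s (j ∷ js)))
      (ℚ.+-assoc y (if r j ℕ.≡ᵇ t then w j else 0ℚ) (sumOver (λ j → if r j ℕ.≡ᵇ t then w j else 0ℚ) js))
      (arriveIf-table t js (one (r j ℕ.≡ᵇ t)))
    where
    one : ∀ b → TableInvariant (y + (if b then w j else 0ℚ)) (if b then arrive t j s else s)
    one true  = arrive-table t j inv
    one false = subst (λ x → TableInvariant x s) (sym (ℚ.+-identityʳ y)) inv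

  arriveAll-table : ∀ t {s} → TableInvariant (before t) s → TableInvariant (before (suc t)) (arriveAll t s)
  arriveAll-table t {s} inv =
    subst (λ x → TableInvariant x (arriveAll t s)) (before-suc t) (arriveIf-table t (allFin n) inv)

  arriveAll-L : ∀ t js s → let s' = foldl (arriveIf t) s js in inL s' ≡ inL s × cur s' ≡ cur s × start s' ≡ start s
  arriveAll-L t []       s = refl , refl , refl
  arriveAll-L t (j ∷ js) s with r j ℕ.≡ᵇ t
  ... | true  = arriveAll-L t js (arrive t j s)
  ... | false = arriveAll-L t js s

  -- Weight of the jobs in L

  addToL : Fin n → State → State
  addToL j s = record s { inL = upd (inL s) j true }

  -- The two outcomes of `updL`, so that both invariants are checked without repeating its Boolean
  -- case analysis.
  data UpdLView (t : ℕ) (s : State) : State → Set where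
    unchanged : UpdLView t s s
    added     : ∀ j → cur s ≡ just j → w j * kℚ ≤ arrivedW (start s) t → UpdLView t s (addToL j s)

  <ᵇℚ⇒≤ : ∀ x y → (x <ᵇℚ y) ≡ true → x ≤ y
  <ᵇℚ⇒≤ x y x<y = ≰ᵇ⇒≥ y x (trans (sym (not-involutive (y ℚ.≤ᵇ x))) (cong not x<y))

  updLjob-view : ∀ t s j → cur s ≡ just j → UpdLView t s (updLjob t s j)
  updLjob-view t s j eq = go (inL s j) ((w j * kℚ) <ᵇℚ arrivedW (start s) t)
    (<ᵇℚ⇒≤ (w j * kℚ) (arrivedW (start s) t))
    where
    go : ∀ a b → (b ≡ true → w j * kℚ ≤ arrivedW (start s) t) →
         UpdLView t s (if a then s else (if b then addToL j s else s))
    go true  b     _ = unchanged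
    go false true  h = added j eq (h refl)
    go false false _ = unchanged

  updL-view : ∀ t s → UpdLView t s (updL t s)
  updL-view t s with cur s in eq
  ... | nothing = unchanged
  ... | just j  = updLjob-view t s j eq

  view-table : ∀ {t y s s'} → UpdLView t s s' → TableInvariant y s → TableInvariant y s'
  view-table unchanged     inv = inv
  view-table (added _ _ _) inv = record
    { rem≤p = rem≤p inv ; blocked = blocked inv ; rejW≤cost = rejW≤cost inv
    ; charge⁺ = charge⁺ inv ; charge⁻ = charge⁻ inv }

  mid-table : ∀ t {s} → TableInvariant (before t) s → TableInvariant (before (suc t)) (mid t s)
  mid-table t {s} inv = view-table (updL-view t (arriveAll t s)) (arriveAll-table t inv)

  upd-∸-≤ : ∀ f j → (∀ i → f i ℕ.≤ p i) → ∀ i → upd f j (f j ∸ 1) i ℕ.≤ p i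
  upd-∸-≤ f j f≤p i with i Fin.≟ j
  ... | yes refl = ℕ.≤-trans (ℕ.m∸n≤m (f i) 1) (f≤p i)
  ... | no  _    = f≤p i

  step-table : ∀ t {s s'} → Step t s s' → TableInvariant (before t) s → TableInvariant (before (suc t)) s'
  step-table t {s} (continue j _ _) inv = let m = mid-table t inv in record
    { rem≤p = upd-∸-≤ (rem (mid t s)) j (rem≤p m) ; blocked = blocked m ; rejW≤cost = rejW≤cost m
    ; charge⁺ = charge⁺ m ; charge⁻ = charge⁻ m }
  step-table t {s} (pick j _ _ _) inv = let m = mid-table t inv in record
    { rem≤p = upd-∸-≤ (rem (mid t s)) j (rem≤p m) ; blocked = blocked m ; rejW≤cost = rejW≤cost m
    ; charge⁺ = charge⁺ m ; charge⁻ = charge⁻ m }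
  step-table t {s} (idle _ _) inv = let m = mid-table t inv in record
    { rem≤p = rem≤p m ; blocked = blocked m ; rejW≤cost = rejW≤cost m
    ; charge⁺ = charge⁺ m ; charge⁻ = charge⁻ m }

  -- A job entering L is paid for by the jobs that arrived since it was started; these intervals are
  -- disjoint for different jobs, as 𝒜 starts a new job immediately afterwards.
  LInvariant : ℕ → (Fin n → Bool) → Maybe (Fin n) → ℕ → Set
  LInvariant t L c a = kℚ * ∑If L w ≤ before t ×
    (∀ j → c ≡ just j → kℚ * ∑If L w ≤ before (suc a) × a ℕ.≤ t)

  continues⇒∉L : ∀ s j → cur s ≡ just j → continues s ≡ true → inL s j ≡ false
  continues⇒∉L s j eq c with cur s | eq
  ... | just .j | refl with 0 ℕ.<ᵇ rem s j | inL s j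
  ...   | true | false = refl

  -- If j enters L, the arrivals in (start, t] pay for it, on top of the weight released up to its
  -- start, which covers the older members of L. The bound at the start time is kept only under
  -- `continues`: a job just added is about to be replaced.
  view-L : ∀ t {s s'} → UpdLView t s s' → LInvariant t (inL s) (cur s) (start s) →
    kℚ * LW s' ≤ before (suc t) ×
    (∀ j → cur s' ≡ just j → continues s' ≡ true → kℚ * LW s' ≤ before (suc (start s')) × start s' ℕ.≤ t)
  view-L t unchanged (le , current) = ℚ.≤-trans le (before-mono-suc t) , λ j eq _ → current j eq
  view-L t {s} (added j eq paid) (_ , current) with le , a≤t ← current j eq = (begin
    kℚ * LW (addToL j s)                          ≤⟨ *-monoˡ-≤ {kℚ} (ℕtoℚ-nonNeg k) (∑If-upd (inL s) j true) ⟩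
    kℚ * (LW s + w j)                             ≡⟨ solve 3 (λ a b c → a :* (b :+ c) := a :* b :+ c :* a) refl kℚ (LW s) (w j) ⟩
    kℚ * LW s + w j * kℚ                          ≤⟨ ℚ.+-mono-≤ le paid ⟩
    before (suc (start s)) + arrivedW (start s) t ≡⟨ before+arrivedW a≤t ⟩
    before (suc t)                                ∎) ,
    -- The current job is now in L, so it cannot continue.
    λ i eq' c → contradiction (trans (sym (continues⇒∉L (addToL j s) i eq' c)) (inL-i i eq')) λ ()
    where
    open ℚ.≤-Reasoning hiding (start)
    inL-i : ∀ i → cur s ≡ just i → upd (inL s) j true i ≡ true
    inL-i i eq' with refl ← trans (sym eq) eq' = cong (λ b → if b then true else inL s j) (dec-true (j Fin.≟ j) refl)

  mid-L : ∀ t s → LInvariant t (inL s) (cur s) (start s) →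
    kℚ * LW (mid t s) ≤ before (suc t) ×
    (∀ j → cur (mid t s) ≡ just j → continues (mid t s) ≡ true →
      kℚ * LW (mid t s) ≤ before (suc (start (mid t s))) × start (mid t s) ℕ.≤ t)
  mid-L t s inv = view-L t (updL-view t (arriveAll t s)) (transport (arriveAll-L t (allFin n) s))
    where
    transport : ∀ {L c a} → L ≡ inL s × c ≡ cur s × a ≡ start s → LInvariant t L c a
    transport (refl , refl , refl) = inv

  step-L : ∀ t {s s'} → Step t s s' → LInvariant t (inL s) (cur s) (start s) →
    LInvariant (suc t) (inL s') (cur s') (start s')
  step-L t {s} (continue j eq c) inv with le , current ← mid-L t s inv =
    le , λ i eq' → let le' , a≤t = current i eq' c in le' , ℕ.m≤n⇒m≤1+n a≤t
  -- The new job starts at t, so the bound by `before (suc t)` is already its bound at the start: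
  -- all weight spent so far arrived by then.
  step-L t {s} (pick j _ _ _) inv with le , _ ← mid-L t s inv = le , λ _ _ → le , ℕ.n≤1+n t
  step-L t {s} (idle _ _)     inv with le , _ ← mid-L t s inv = le , λ _ ()

  init-table : TableInvariant (before 0) init
  init-table = record
    { rem≤p = λ _ → ℕ.≤-refl ; blocked = []
    ; rejW≤cost = ℚ.≤-reflexive (sumOver-0 (allFin n))
    ; charge⁺ = 0≤∑If (λ i → r i ℕ.<ᵇ 0) ; charge⁻ = 0≤∑If (λ i → r i ℕ.<ᵇ 0) }

  init-L : LInvariant 0 (λ _ → false) nothing 0
  init-L = ℚ.≤-trans (ℚ.≤-reflexive (trans (cong (kℚ *_) (sumOver-0 (allFin n))) (ℚ.*-zeroʳ kℚ)))
    (0≤∑If (λ i → r i ℕ.<ᵇ 0)) , λ _ ()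

  run-invariants : ∀ {σ} → IsRun σ → ∀ t →
    TableInvariant (before t) (σ t) × LInvariant t (inL (σ t)) (cur (σ t)) (start (σ t))
  run-invariants {σ} (σ0≡init , _) zero =
    subst (λ s → TableInvariant (before 0) s × LInvariant 0 (inL s) (cur s) (start s))
      (sym σ0≡init) (init-table , init-L)
  run-invariants {σ} run@(_ , steps) (suc t) with tab , l ← run-invariants run t =
    step-table t (steps t) tab , step-L t (steps t) l

  -- The final estimate

  k*cost⁺ : ∀ xs → All IsBlocked xs → sumOver lower⁺ xs ≤ totalW → kℚ * cost⁺ xs ≤ + 34 / 1 * totalW
  k*cost⁺ xs isBlocked charge with N , xs⊆grid ← ⊆key-grid xs = begin
    kℚ * cost⁺ xs
      ≤⟨ k*sumByRank-rejected⁺ _==⁺_ ==⁺-refl ==⁺-sound k upper⁺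
           (λ u → *-nonNeg {2ℚ} {lower⁺ u} (ℕtoℚ-nonNeg 2) (pow2-nonNeg (proj₂ u))) (key-grid-unique N) xs⊆grid ⟩
    sumOver upper⁺ xs + kℚ * F N
      ≤⟨ ℚ.+-mono-≤
           (ℚ.≤-trans (ℚ.≤-reflexive (sumOver-* 2ℚ lower⁺ xs)) (*-monoˡ-≤ {2ℚ} (ℕtoℚ-nonNeg 2) charge))
           (*-monoˡ-≤ {kℚ} (ℕtoℚ-nonNeg k) (sumOver-first-keys (allFin n) pℚ ρ k (λ j → ℕtoℚ-nonNeg (p j)) (λ j → pos⇒0≤ (0<ρ j)) ε 0≤ε εk≡1 N isBlocked)) ⟩
    -- The 2 is the ratio of `upper⁺` to `lower⁺`; the 32 comes from the first jobs, and k cancels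
    -- its ε.
    2ℚ * totalW + kℚ * (32ℚ * ε * ∑ (λ a → pℚ a * ρ a))
      ≡⟨ cong (λ y → 2ℚ * totalW + kℚ * (32ℚ * ε * y))
           (sumOver-cong _ _ (allFin n) (λ a → trans (ℚ.*-comm (pℚ a) (ρ a)) (ρp≡w a))) ⟩
    2ℚ * totalW + kℚ * (32ℚ * ε * totalW)
      ≡⟨ solve 3 (λ a b c → con 2ℚ :* a :+ b :* (con 32ℚ :* c :* a) := con 2ℚ :* a :+ con 32ℚ :* (c :* b) :* a)
           refl totalW kℚ ε ⟩
    2ℚ * totalW + 32ℚ * (ε * kℚ) * totalW
      ≡⟨ cong (λ y → 2ℚ * totalW + 32ℚ * y * totalW) εk≡1 ⟩
    2ℚ * totalW + 32ℚ * 1ℚ * totalW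
      ≡⟨ solve 1 (λ a → con 2ℚ :* a :+ con 32ℚ :* con 1ℚ :* a := con (+ 34 / 1) :* a) refl totalW ⟩
    + 34 / 1 * totalW ∎
    where
    open ℚ.≤-Reasoning
    F : ℕ → ℚ
    F N = sumOver (λ u → if 0 ℕ.<ᵇ count (u ==⁺_) xs then upper⁺ u else 0ℚ) (key-grid N)

  k*cost⁻ : ∀ xs → sumOver lower⁻ xs ≤ totalW → kℚ * cost⁻ xs ≤ 4ℚ * totalW
  k*cost⁻ xs charge = begin
    kℚ * cost⁻ xs          ≤⟨ k*sumByRank-rejected⁻ _==⁻_ ==⁻-refl ==⁻-sound k upper⁻ 0≤upper⁻ xs ⟩
    sumOver upper⁻ xs      ≡⟨ sumOver-* 4ℚ lower⁻ xs ⟩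
    4ℚ * sumOver lower⁻ xs ≤⟨ *-monoˡ-≤ {4ℚ} (ℕtoℚ-nonNeg 4) charge ⟩
    4ℚ * totalW            ∎
    where
    open ℚ.≤-Reasoning
    0≤upper⁻ : ∀ u → 0ℚ ≤ upper⁻ u
    0≤upper⁻ (_ , c , b) = *-nonNeg {4ℚ} {pow2 c * pow2 b} (ℕtoℚ-nonNeg 4)
      (*-nonNeg {pow2 c} {pow2 b} (pow2-nonNeg c) (pow2-nonNeg b))

  -- The estimate is made k-fold and then multiplied by ε = 1/k: 39 is 34 for T⁺, 4 for T⁻ and 1 for
  -- L.
  rejW+LW≤ : ∀ {σ} → IsRun σ → ∀ t → rejW (σ t) + LW (σ t) ≤ + 39 / 1 * ε * totalW
  rejW+LW≤ {σ} run t = begin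
    rejW s + LW s                       ≡⟨ ℚ.*-identityˡ (rejW s + LW s) ⟨
    1ℚ * (rejW s + LW s)                ≡⟨ cong (_* (rejW s + LW s)) εk≡1 ⟨
    ε * kℚ * (rejW s + LW s)            ≡⟨ ℚ.*-assoc ε kℚ (rejW s + LW s) ⟩
    ε * (kℚ * (rejW s + LW s))          ≤⟨ *-monoˡ-≤ {ε} 0≤ε bound ⟩
    ε * (+ 39 / 1 * totalW)             ≡⟨ solve 2 (λ a b → a :* (con (+ 39 / 1) :* b) := con (+ 39 / 1) :* a :* b) refl ε totalW ⟩
    + 39 / 1 * ε * totalW               ∎
    where
    open ℚ.≤-Reasoning
    s = σ t
    before≤W : before t ≤ totalW
    before≤W = ∑If≤totalW (λ i → r i ℕ.<ᵇ t)
    bound : kℚ * (rejW s + LW s) ≤ + 39 / 1 * totalW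
    bound with tab , l ← run-invariants run t = begin
      kℚ * (rejW s + LW s)
        ≤⟨ *-monoˡ-≤ {kℚ} (ℕtoℚ-nonNeg k) (ℚ.+-monoˡ-≤ (LW s) (rejW≤cost tab)) ⟩
      kℚ * (cost⁺ (T⁺ s) + cost⁻ (T⁻ s) + LW s)
        ≡⟨ solve 4 (λ x a b c → x :* (a :+ b :+ c) := x :* a :+ x :* b :+ x :* c) refl
             kℚ (cost⁺ (T⁺ s)) (cost⁻ (T⁻ s)) (LW s) ⟩
      kℚ * cost⁺ (T⁺ s) + kℚ * cost⁻ (T⁻ s) + kℚ * LW s
        ≤⟨ ℚ.+-mono-≤ (ℚ.+-mono-≤ (k*cost⁺ (T⁺ s) (blocked tab) (ℚ.≤-trans (charge⁺ tab) before≤W))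
                                  (k*cost⁻ (T⁻ s) (ℚ.≤-trans (charge⁻ tab) before≤W)))
                      (ℚ.≤-trans (proj₁ l) before≤W) ⟩
      + 34 / 1 * totalW + 4ℚ * totalW + totalW
        ≡⟨ solve 1 (λ a → con (+ 34 / 1) :* a :+ con 4ℚ :* a :+ a := con (+ 39 / 1) :* a) refl totalW ⟩
      + 39 / 1 * totalW ∎

theorem4p1 : Σ ℕ λ C →
    (ε : ℚ) (k : ℕ) → Positive ε → ε * (+ k / 1) ≡ 1ℚ → ε * ε ≤ ½ →
    {n : ℕ} (r : Fin n → ℕ) (p : Fin n → ℕ) (w : Fin n → ℚ) →
    (∀ j → 0 < p j) → (∀ j → Positive (w j)) →
    (σ : ℕ → Alg.State k r p w) → Alg.IsRun k r p w σ →
    (t : ℕ) →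
    Alg.rejW k r p w (σ t) + Alg.LW k r p w (σ t) ≤ ((+ C / 1) * ε) * Alg.totalW k r p w
theorem4p1 = 39 , bound
  where
  bound : (ε : ℚ) (k : ℕ) → Positive ε → ε * (+ k / 1) ≡ 1ℚ → ε * ε ≤ ½ →
    {n : ℕ} (r : Fin n → ℕ) (p : Fin n → ℕ) (w : Fin n → ℚ) →
    (∀ j → 0 < p j) → (∀ j → Positive (w j)) →
    (σ : ℕ → Alg.State k r p w) → Alg.IsRun k r p w σ →
    (t : ℕ) →
    Alg.rejW k r p w (σ t) + Alg.LW k r p w (σ t) ≤ ((+ 39 / 1) * ε) * Alg.totalW k r p w
  -- k = 0 would give 0 = 1; the other clause supplies the nonzero k for `Rejections`.
  bound ε zero      0<ε ε0≡1 = contradiction (trans (sym (ℚ.*-zeroʳ ε)) ε0≡1) λ ()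
  bound ε k@(suc _) 0<ε εk≡1 _ r p w 0<p 0<w σ run t =
    Rejections.rejW+LW≤ ε k (pos⇒0≤ 0<ε) εk≡1 r p w 0<p 0<w run t
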